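{- For every prime power $q$ and every integer $n \geq 2$, there exists a resolvable $\left(\frac{q^n - 1}{q - 1} \times q^n,\ \frac{q(q^n - 1)}{q - 1}\right)$-unordered triple array.
   Context: An $(r \times c, v)$-unordered triple array on a set $V$ of $v$ symbols is a collection of $c$-subsets $R_1, \dots, R_r \subseteq V$ (row-sets) and $r$-subsets $C_1, \dots, C_c \subseteq V$ (column-sets) such that, for some integers $e, \lambda_{rc}, \lambda_{rr}, \lambda_{cc}$, each symbol lies in exactly $e$ row-sets and exactly $e$ column-sets, $|R_i \cap C_j| = \lambda_{rc}$ for all $i,j$, $|R_i \cap R_s| = \lambda_{rr}$ for all $i \neq s$, and $|C_j \cap C_t| = \lambda_{cc}$ for all $j \neq t$. Necessarily $e = rc/v$. Such an unordered triple array is called resolvable if $\lambda_{rrc} := \frac{e(e-1)}{r-1}$ and $k := \frac{c}{e}$ are integers and the symbol set can be partitioned into $r$ groups of size $k$ such that every column-set contains exactly one symbol from each group, and all symbols of a group lie in exactly the same row-sets. -}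

module Defs where

open import Data.Nat using (ℕ; _+_; _*_; _∸_; _^_; _<_; _≤_)
open import Data.Nat.Primality using (Prime)
open import Data.Nat.Divisibility using (_∣_)
open import Data.Fin using (Fin; _≟_)
open import Relation.Nullary.Decidable using (⌊_⌋)
open import Data.Fin.Subset using (Subset; _∩_; ∣_∣)
open import Data.Vec using (lookup; tabulate)
open import Data.Bool using (Bool)
open import Data.Product using (Σ; _×_; ∃)
open import Relation.Binary.PropositionalEquality using (_≡_; _≢_)

IsPrimePower : ℕ → Set
IsPrimePower q = Σ ℕ λ p → Σ ℕ λ m → Prime p × 1 ≤ m × q ≡ p ^ m

containing : ∀ {m v} → (Fin m → Subset v) → Fin v → Subset m
containing S x = tabulate λ i → lookup (S i) x

record UTA (r c v : ℕ) : Set where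
  field
    R : Fin r → Subset v
    C : Fin c → Subset v
    e λrc λrr λcc : ℕ
    R-size : ∀ i → ∣ R i ∣ ≡ c
    C-size : ∀ j → ∣ C j ∣ ≡ r
    R-rep : ∀ x → ∣ containing R x ∣ ≡ e
    C-rep : ∀ x → ∣ containing C x ∣ ≡ e
    RC : ∀ i j → ∣ R i ∩ C j ∣ ≡ λrc
    RR : ∀ i s → i ≢ s → ∣ R i ∩ R s ∣ ≡ λrr
    CC : ∀ j t → j ≢ t → ∣ C j ∩ C t ∣ ≡ λcc

group : ∀ {r v} → (Fin v → Fin r) → Fin r → Subset v
group g l = tabulate λ x → ⌊ g x ≟ l ⌋

-- Resolvability: λrrc = e(e-1)/(r-1) and k = c/e are integers (denominators
-- nonzero), and there is a partition of V into r groups of size k (given by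
-- g : V → Fin r) such that every column-set meets every group in exactly one
-- symbol, and symbols of the same group lie in exactly the same row-sets.
record Resolvable {r c v : ℕ} (A : UTA r c v) : Set where
  open UTA A
  field
    λrrc k : ℕ
    r>1 : 1 < r
    λrrc-int : λrrc * (r ∸ 1) ≡ e * (e ∸ 1)
    e>0 : 0 < e
    k-int : k * e ≡ c
    g : Fin v → Fin r
    group-size : ∀ l → ∣ group g l ∣ ≡ k
    column-transversal : ∀ j l → ∣ C j ∩ group g l ∣ ≡ 1
    same-rows : ∀ x y → g x ≡ g y → ∀ i → lookup (R i) x ≡ lookup (R i) y

ResolvableUTA : ℕ → ℕ → ℕ → Set
ResolvableUTA r c v = Σ (UTA r c v) Resolvable

{-# OPTIONS --safe #-}

-- The symbols are the affine hyperplanes of K^n, K = GF(q), the groups are the parallel classes and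
-- the columns are the points: a point lies on one hyperplane of each class.  A class is given by a
-- normalised normal vector a, that is, by a point of projective space; the row of i ∈ PG(n-1,q)
-- consists of all hyperplanes whose normal is not orthogonal to i.
--
-- GF(p^m) is obtained without factoring polynomials.  In A = 𝔽_p[X]/(X^q − X) every element satisfies
-- a^q = a, so a^(q-1) is idempotent, and the residue fields of A are its components at primitive
-- idempotents.  The product of the X^(p^d) − X for 0 < d < m has degree less than q, hence is nonzero
-- in A and survives in some residue field.  There X has m distinct conjugates, so the field has at
-- least p^m elements, and it has at most q because all of them are roots of X^q − X.

module Submission where

open import Defs
open import Level using (0ℓ; _⊔_)
open import Algebra.Bundles using (CommutativeRing)
open import Algebra.Structures using (IsCommutativeRing)
import Algebra.Properties.CommutativeMonoid.Sum
import Algebra.Properties.CommutativeSemiring.Binomial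
import Algebra.Properties.CommutativeSemiring.Exp
import Algebra.Properties.Group
import Algebra.Properties.Ring
import Algebra.Properties.Semiring.Mult
import Algebra.Properties.Semiring.Sum
import Algebra.Solver.Ring.NaturalCoefficients.Default
open import Data.Bool using (Bool; true; false; _∧_; not)
open import Data.Fin as Fin using (Fin; toℕ; fromℕ; inject₁; _↑ˡ_; _↑ʳ_; splitAt; join; remQuot; combine)
import Data.Fin.Properties as Fin
open import Data.Fin.Induction using (spo-wellFounded)
open import Data.Fin.Subset using (Subset; _∩_; ∣_∣)
open import Data.Nat as ℕ using (ℕ; zero; suc; NonZero; _≤_; _<_; z≤n; s≤s; _%_; _/_; _∸_; _!)
import Data.Nat.Properties as ℕ
open import Data.Nat.Combinatorics using (_C_; nCk≡n!/k![n-k]!; nCn≡1; k![n∸k]!∣n!)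
open import Data.Nat.Coprimality using (coprime-Bézout; prime⇒coprime)
open import Data.Nat.DivMod using (_mod_; m/n*n≡m; m≡m%n+[m/n]*n; m%n<n; m*n%n≡0; n%n≡0; m<n⇒m%n≡m; [m+n]%n≡m%n; %-distribˡ-+)
open import Data.Nat.Divisibility using (_∣_; divides; ∣⇒≤; m∣m*n; ∣1⇒≡1; m%n≡0⇒n∣m)
open import Data.Nat.GCD using (module Bézout)
open import Data.Nat.Induction using (<-rec)
open import Data.Nat.Primality using (Prime; euclidsLemma; prime⇒nonTrivial; prime⇒nonZero)
open import Data.Nat.Tactic.RingSolver using (solve-∀)
open import Data.Product using (∃; _×_; _,_; proj₁; proj₂)
open import Data.Sum using (_⊎_; inj₁; inj₂)
open import Data.Vec as Vec using (Vec; []; _∷_; _∷ʳ_; tabulate; lookup)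
open import Data.Vec.Properties using (lookup∘tabulate)
open import Data.Vec.Relation.Unary.All as All using (All; []; _∷_)
open import Induction.WellFounded using (Acc; acc)
open import Relation.Nullary using (Dec; yes; no; ¬_; contradiction; ¬?; _×-dec_)
open import Relation.Nullary.Decidable using (⌊_⌋; map′)
open import Relation.Binary.Definitions using (tri<; tri≈; tri>)
open import Relation.Binary.Structures using (IsStrictPartialOrder)
open import Relation.Binary.PropositionalEquality as ≡ using (_≡_; _≢_; cong; cong₂; module ≡-Reasoning)

-- Rows come from complements of hyperplanes because of the required size: q^(n-1) classes have a
-- normal not orthogonal to i, which gives q · q^(n-1) = q^n symbols, while the orthogonal classes
-- are too few. Row membership depends on the class alone and a column holds one symbol of each
-- class, so the sizes and intersections reduce to counting normalised vectors: those not orthogonal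
-- to one nonzero vector, and those orthogonal to neither of two independent ones. The second count
-- follows from the first by summing over the pencil z + t y.
--
-- A primitive idempotent is found by search, so A needs decidable equality and a finite list of
-- elements. Therefore its elements are expressions compared through the first q values of one
-- recurrent sequence, and the list consists of the combinations of 1, X, ..., X^(q-1). It does not
-- matter which residue field the search reaches, since any one in which the product survives has
-- exactly q elements.

-- Binomial coefficients modulo a prime

prime∤! : ∀ {p} → Prime p → ∀ k → k < p → ¬ p ∣ k !
prime∤! {p} pp zero    k<p p∣1 = contradiction (∣1⇒≡1 p∣1) (ℕ.>⇒≢ (ℕ.nonTrivial⇒n>1 p {{prime⇒nonTrivial pp}}))
prime∤! pp (suc k) k<p p∣k! with euclidsLemma (suc k) (k !) pp p∣k!
... | inj₁ p∣k  = contradiction (∣⇒≤ p∣k) (ℕ.<⇒≱ k<p)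
... | inj₂ p∣k! = prime∤! pp k (ℕ.<-trans (ℕ.n<1+n k) k<p) p∣k!

-- The prime divides p! = C · k! · (p - k)!, but neither of the two factorials.
prime∣C : ∀ {p} → Prime p → ∀ k → 0 < k → k < p → p ∣ p C k
prime∣C {p} pp k 0<k k<p with euclidsLemma (p C k) (k ! ℕ.* (p ℕ.∸ k) !) pp p∣p!
  where
  instance _ = k ℕ.!* (p ℕ.∸ k) !≢0
  C*d≡p! : (p C k) ℕ.* (k ! ℕ.* (p ℕ.∸ k) !) ≡ p !
  C*d≡p! = ≡.trans (≡.cong (ℕ._* (k ! ℕ.* (p ℕ.∸ k) !)) (nCk≡n!/k![n-k]! (ℕ.<⇒≤ k<p)))
                   (m/n*n≡m (k![n∸k]!∣n! (ℕ.<⇒≤ k<p)))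
  p∣! : ∀ p → 0 < p → p ∣ p !
  p∣! (suc p) _ = m∣m*n (p !)
  p∣p! : p ∣ (p C k) ℕ.* (k ! ℕ.* (p ℕ.∸ k) !)
  p∣p! = ≡.subst (p ∣_) (≡.sym C*d≡p!) (p∣! p (ℕ.≤-<-trans z≤n k<p))
... | inj₁ p∣C = p∣C
... | inj₂ p∣d with euclidsLemma (k !) ((p ℕ.∸ k) !) pp p∣d
...   | inj₁ p∣k!  = contradiction p∣k! (prime∤! pp k k<p)
...   | inj₂ p∣pk! = contradiction p∣pk! (prime∤! pp (p ℕ.∸ k) (ℕ.∸-monoʳ-< 0<k (ℕ.<⇒≤ k<p)))

-- Additivity of the Frobenius map

module Frobenius {c ℓ} (R : CommutativeRing c ℓ) where

  open CommutativeRing R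
  open Algebra.Properties.Semiring.Mult semiring renaming (_×_ to _××_)
  open Algebra.Properties.CommutativeSemiring.Exp commutativeSemiring
  open Algebra.Properties.CommutativeMonoid.Sum +-commutativeMonoid
  open import Relation.Binary.Reasoning.Setoid setoid
  private
    module B = Algebra.Properties.CommutativeSemiring.Binomial commutativeSemiring

  module Characteristic {p : ℕ} (pp : Prime p) (p×1≈0 : p ×× 1# ≈ 0#) where

    p×x≈0 : ∀ x → p ×× x ≈ 0#
    p×x≈0 x = begin
      p ×× x          ≈⟨ ×-congʳ p (*-identityˡ x) ⟨
      p ×× (1# * x)   ≈⟨ ×-assoc-* p 1# x ⟨
      (p ×× 1#) * x   ≈⟨ *-congʳ p×1≈0 ⟩
      0# * x         ≈⟨ zeroˡ x ⟩
      0#             ∎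

    p∣n⇒n×x≈0 : ∀ {n} → p ∣ n → ∀ x → n ×× x ≈ 0#
    p∣n⇒n×x≈0 (divides k ≡.refl) x = begin
      (k ℕ.* p) ×× x  ≡⟨ ≡.cong (_×× x) (ℕ.*-comm k p) ⟩
      (p ℕ.* k) ×× x  ≈⟨ ×-assocˡ x p k ⟨
      p ×× (k ×× x)    ≈⟨ p×x≈0 _ ⟩
      0#             ∎

    frobenius-+ : ∀ x y → (x + y) ^ p ≈ x ^ p + y ^ p
    frobenius-+ x y = go p ≡.refl
      where
      -- The exponent becomes a variable equal to p, so that it can be matched as a successor and
      -- the first and last binomial terms split off.
      go : ∀ n → n ≡ p → (x + y) ^ n ≈ x ^ n + y ^ n
      go zero    0≡p = contradiction 0≡p (ℕ.<⇒≢ (ℕ.<-trans (s≤s z≤n) (ℕ.nonTrivial⇒n>1 p {{prime⇒nonTrivial pp}})))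
      go (suc n) n≡p = begin
        (x + y) ^ suc n
          ≈⟨ B.theorem (suc n) x y ⟩
        t Fin.zero + sum (λ i → t (Fin.suc i))
          ≈⟨ +-cong first (sum-init-last (λ i → t (Fin.suc i))) ⟩
        y ^ suc n + (sum (λ i → t (Fin.suc (inject₁ i))) + t (Fin.suc (fromℕ n)))
          ≈⟨ +-congˡ (+-cong (trans (sum-cong-≋ middle) (sum-replicate-zero n)) top) ⟩
        y ^ suc n + (0# + x ^ suc n)
          ≈⟨ trans (+-congˡ (+-identityˡ _)) (+-comm _ _) ⟩
        x ^ suc n + y ^ suc n ∎
        where
        t : Fin (suc (suc n)) → Carrier
        t = B.binomialTerm x y (suc n)
        first : t Fin.zero ≈ y ^ suc n
        first = trans (×-homo-1 _) (*-identityˡ _)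
        middle : ∀ (i : Fin n) → t (Fin.suc (inject₁ i)) ≈ 0#
        middle i = p∣n⇒n×x≈0
          (≡.subst (λ m → p ∣ m C suc (toℕ (inject₁ i))) (≡.sym n≡p)
            (prime∣C pp _ (s≤s z≤n)
              (≡.subst (suc (toℕ (inject₁ i)) <_) n≡p (s≤s (≡.subst (_< n) (≡.sym (Fin.toℕ-inject₁ i)) (Fin.toℕ<n i)))))) _
        top : t (Fin.suc (fromℕ n)) ≈ x ^ suc n
        top = begin
          t (Fin.suc (fromℕ n))
            ≡⟨ ≡.cong (λ m → (suc n C suc m) ×× ((x ^ suc m) * (y ^ (n ℕ.∸ m)))) (Fin.toℕ-fromℕ n) ⟩
          (suc n C suc n) ×× ((x ^ suc n) * (y ^ (n ℕ.∸ n)))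
            ≡⟨ ≡.cong₂ (λ m k → m ×× (x ^ suc n * y ^ k)) (nCn≡1 (suc n)) (ℕ.n∸n≡0 n) ⟩
          1 ×× (x ^ suc n * 1#)
            ≈⟨ trans (×-homo-1 _) (*-identityʳ _) ⟩
          x ^ suc n ∎

    frobenius^-+ : ∀ d x y → (x + y) ^ (p ℕ.^ d) ≈ x ^ (p ℕ.^ d) + y ^ (p ℕ.^ d)
    frobenius^-+ zero    x y = trans (*-identityʳ _) (+-cong (sym (*-identityʳ x)) (sym (*-identityʳ y)))
    frobenius^-+ (suc d) x y = begin
      (x + y) ^ (p ℕ.* p ℕ.^ d)                         ≈⟨ ^-assocʳ (x + y) p (p ℕ.^ d) ⟨
      ((x + y) ^ p) ^ (p ℕ.^ d)                         ≈⟨ ^-congˡ (p ℕ.^ d) (frobenius-+ x y) ⟩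
      (x ^ p + y ^ p) ^ (p ℕ.^ d)                       ≈⟨ frobenius^-+ d (x ^ p) (y ^ p) ⟩
      (x ^ p) ^ (p ℕ.^ d) + (y ^ p) ^ (p ℕ.^ d)         ≈⟨ +-cong (^-assocʳ x p _) (^-assocʳ y p _) ⟩
      x ^ (p ℕ.* p ℕ.^ d) + y ^ (p ℕ.* p ℕ.^ d)         ∎

-- Polynomials as coefficient vectors and their roots

module Polynomials {c ℓ} (R : CommutativeRing c ℓ) where

  open CommutativeRing R
  open Algebra.Properties.CommutativeSemiring.Exp commutativeSemiring using (_^_)
  open import Relation.Binary.Reasoning.Setoid setoid
  open Algebra.Solver.Ring.NaturalCoefficients.Default commutativeSemiring

  eval : ∀ {n} → Vec Carrier n → Carrier → Carrier
  eval []      x = 0#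
  eval (a ∷ f) x = a + x * eval f x

  -- Synthetic division by X - a, constant term first: the coefficients of the quotient are the
  -- values at a of the successive tails of f.
  quotient : ∀ {n} → Vec Carrier (suc n) → Carrier → Vec Carrier n
  quotient (_ ∷ [])        a = []
  quotient (_ ∷ f@(_ ∷ _)) a = eval f a ∷ quotient f a

  -- f(x) − f(a) = (x − a) · quotient, with the negative terms moved across.
  eval-quotient : ∀ {n} (f : Vec Carrier (suc n)) a x →
    eval f x + a * eval (quotient f a) x ≈ x * eval (quotient f a) x + eval f a
  eval-quotient (c ∷ []) a x =
    solve 3 (λ c a x → (c :+ x :* con 0) :+ a :* con 0 := x :* con 0 :+ (c :+ a :* con 0)) refl c a x
  eval-quotient (c ∷ f@(_ ∷ _)) a x = begin
    (c + x * F) + a * (Fa + x * Q)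
      ≈⟨ solve 6 (λ c x F a Fa Q → (c :+ x :* F) :+ a :* (Fa :+ x :* Q) := (c :+ a :* Fa) :+ x :* (F :+ a :* Q)) refl c x F a Fa Q ⟩
    (c + a * Fa) + x * (F + a * Q)
      ≈⟨ +-congˡ (*-congˡ (eval-quotient f a x)) ⟩
    (c + a * Fa) + x * (x * Q + Fa)
      ≈⟨ solve 5 (λ c x a Fa Q → (c :+ a :* Fa) :+ x :* (x :* Q :+ Fa) := x :* (Fa :+ x :* Q) :+ (c :+ a :* Fa)) refl c x a Fa Q ⟩
    x * (Fa + x * Q) + (c + a * Fa) ∎
    where
    F = eval f x ; Fa = eval f a ; Q = eval (quotient f a) x

  -- The head of the quotient is the value at a of the tail of f. Its vanishing leaves only the
  -- constant term in f(a), and it is also the remainder hypothesis for the recursion.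
  quotient≈0⇒≈0 : ∀ {n} (f : Vec Carrier (suc n)) a →
    All (_≈ 0#) (quotient f a) → eval f a ≈ 0# → All (_≈ 0#) f
  quotient≈0⇒≈0 (c ∷ []) a [] fa≈0 = trans (sym (trans (+-congˡ (zeroʳ a)) (+-identityʳ c))) fa≈0 ∷ []
  quotient≈0⇒≈0 (c ∷ f@(_ ∷ _)) a (Fa≈0 ∷ q≈0) fa≈0 =
    trans (sym (trans (+-congˡ (trans (*-congˡ Fa≈0) (zeroʳ a))) (+-identityʳ c))) fa≈0
      ∷ quotient≈0⇒≈0 f a q≈0 Fa≈0

  monomial : ∀ n → Vec Carrier (suc n)
  monomial zero    = 1# ∷ []
  monomial (suc n) = 0# ∷ monomial n

  eval-monomial : ∀ n x → eval (monomial n) x ≈ x ^ n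
  eval-monomial zero    x = trans (+-congˡ (zeroʳ x)) (+-identityʳ 1#)
  eval-monomial (suc n) x = trans (+-identityˡ _) (*-congˡ (eval-monomial n x))

  monomial≉0 : ∀ n → All (_≈ 0#) (monomial n) → 1# ≈ 0#
  monomial≉0 zero    (1≈0 ∷ []) = 1≈0
  monomial≉0 (suc n) (_ ∷ all)  = monomial≉0 n all

  module Roots (domain : ∀ x y → x * y ≈ 0# → x ≈ 0# ⊎ y ≈ 0#) where

    cancelʳ : ∀ x y z → x * z ≈ y * z → x ≈ y ⊎ z ≈ 0#
    cancelʳ x y z xz≈yz with domain (x - y) z [x-y]z≈0
      where
      [x-y]z≈0 : (x - y) * z ≈ 0#
      [x-y]z≈0 = begin
        (x - y) * z       ≈⟨ Algebra.Properties.Ring.[y-z]x≈yx-zx ring z x y ⟩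
        x * z - y * z     ≈⟨ +-congʳ xz≈yz ⟩
        y * z - y * z     ≈⟨ -‿inverseʳ (y * z) ⟩
        0#                ∎
    ... | inj₁ x-y≈0 = inj₁ (Algebra.Properties.Group.x∙y⁻¹≈ε⇒x≈y +-group x y x-y≈0)
    ... | inj₂ z≈0   = inj₂ z≈0

    -- Length n means degree below n. After division by X - ρ 0 the other roots remain roots of the
    -- quotient, because their differences from ρ 0 cancel in a domain.
    roots⇒≈0 : ∀ {n} (f : Vec Carrier n) (ρ : Fin n → Carrier) →
      (∀ i j → ρ i ≈ ρ j → i ≡ j) → (∀ i → eval f (ρ i) ≈ 0#) → All (_≈ 0#) f
    roots⇒≈0 {zero}  []  ρ ρ-inj fρ≈0 = []
    roots⇒≈0 {suc n} f ρ ρ-inj fρ≈0 =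
      quotient≈0⇒≈0 f a (roots⇒≈0 (quotient f a) (λ i → ρ (Fin.suc i)) suc-inj q-root) (fρ≈0 Fin.zero)
      where
      a = ρ Fin.zero
      suc-inj : ∀ i j → ρ (Fin.suc i) ≈ ρ (Fin.suc j) → i ≡ j
      suc-inj i j eq with ≡.refl ← ρ-inj (Fin.suc i) (Fin.suc j) eq = ≡.refl
      q-root : ∀ i → eval (quotient f a) (ρ (Fin.suc i)) ≈ 0#
      q-root i with cancelʳ a (ρ (Fin.suc i)) (eval (quotient f a) (ρ (Fin.suc i))) (begin
          a * Q               ≈⟨ +-identityˡ _ ⟨
          0# + a * Q          ≈⟨ +-congʳ (fρ≈0 (Fin.suc i)) ⟨
          eval f x + a * Q    ≈⟨ eval-quotient f a x ⟩
          x * Q + eval f a    ≈⟨ +-congˡ (fρ≈0 Fin.zero) ⟩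
          x * Q + 0#          ≈⟨ +-identityʳ _ ⟩
          x * Q               ∎)
        where x = ρ (Fin.suc i) ; Q = eval (quotient f a) x
      ... | inj₁ a≈x with () ← ρ-inj Fin.zero (Fin.suc i) a≈x
      ... | inj₂ q≈0 = q≈0

-- Vectors of digits

toVec : ∀ {n} k → Fin (n ℕ.^ k) → Vec (Fin n) k
toVec         zero    _ = []
toVec {n = n} (suc k) i = proj₁ (remQuot {n} (n ℕ.^ k) i) ∷ toVec k (proj₂ (remQuot {n} (n ℕ.^ k) i))

fromVec : ∀ {n k} → Vec (Fin n) k → Fin (n ℕ.^ k)
fromVec []       = Fin.zero
fromVec (c ∷ cs) = combine c (fromVec cs)

toVec-fromVec : ∀ {n k} (cs : Vec (Fin n) k) → toVec k (fromVec cs) ≡ cs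
toVec-fromVec []                   = ≡.refl
toVec-fromVec {n} {suc k} (c ∷ cs) = ≡.trans
  (≡.cong (λ i → proj₁ i ∷ toVec k (proj₂ i)) (Fin.remQuot-combine {n} {n ℕ.^ k} c (fromVec cs)))
  (≡.cong (c ∷_) (toVec-fromVec cs))

fromVec-toVec : ∀ {n} k (i : Fin (n ℕ.^ k)) → fromVec (toVec k i) ≡ i
fromVec-toVec zero    Fin.zero = ≡.refl
fromVec-toVec {n} (suc k) i =
  ≡.trans (≡.cong (combine (proj₁ (remQuot {n} (n ℕ.^ k) i))) (fromVec-toVec k _)) (Fin.combine-remQuot {n} (n ℕ.^ k) i)

toVec-injective : ∀ {n} k {i j : Fin (n ℕ.^ k)} → toVec k i ≡ toVec k j → i ≡ j
toVec-injective k {i} {j} eq = ≡.trans (≡.sym (fromVec-toVec k i)) (≡.trans (≡.cong fromVec eq) (fromVec-toVec k j))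

-- Combinations of the powers of one element

module LinearSpan {c ℓ} (R : CommutativeRing c ℓ) (x : CommutativeRing.Carrier R) where

  open CommutativeRing R
  open Algebra.Properties.Semiring.Mult semiring renaming (_×_ to _××_)
  open Algebra.Properties.CommutativeSemiring.Exp commutativeSemiring
  open Polynomials R
  open import Relation.Binary.Reasoning.Setoid setoid
  open import Algebra.Properties.CommutativeSemigroup +-commutativeSemigroup using (interchange)

  -- Coefficients are natural numbers rather than residues, so that sums are formed coefficientwise;
  -- `Reduction` brings them below p afterwards.
  lin : ∀ {k} → Vec ℕ k → Carrier
  lin cs = eval (Vec.map (_×× 1#) cs) x

  lin-+ : ∀ {k} (cs ds : Vec ℕ k) → lin cs + lin ds ≈ lin (Vec.zipWith ℕ._+_ cs ds)
  lin-+ []       []       = +-identityˡ 0#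
  lin-+ (c ∷ cs) (d ∷ ds) = begin
    (c ×× 1# + x * lin cs) + (d ×× 1# + x * lin ds)   ≈⟨ interchange _ _ _ _ ⟩
    (c ×× 1# + d ×× 1#) + (x * lin cs + x * lin ds)   ≈⟨ +-cong (×-homo-+ 1# c d) (distribˡ x _ _) ⟨
    (c ℕ.+ d) ×× 1# + x * (lin cs + lin ds)          ≈⟨ +-congˡ (*-congˡ (lin-+ cs ds)) ⟩
    (c ℕ.+ d) ×× 1# + x * lin (Vec.zipWith ℕ._+_ cs ds) ∎

  lin-∷ʳ : ∀ {k} (cs : Vec ℕ k) d → lin (cs ∷ʳ d) ≈ lin cs + d ×× x ^ k
  lin-∷ʳ []       d = trans (+-congˡ (zeroʳ x)) (+-comm _ _)
  lin-∷ʳ {suc k} (c ∷ cs) d = begin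
    c ×× 1# + x * lin (cs ∷ʳ d)              ≈⟨ +-congˡ (*-congˡ (lin-∷ʳ cs d)) ⟩
    c ×× 1# + x * (lin cs + d ×× x ^ k)       ≈⟨ +-congˡ (trans (distribˡ x _ _) (+-congˡ (×-comm-* d x _))) ⟩
    c ×× 1# + (x * lin cs + d ×× x ^ suc k)   ≈⟨ +-assoc _ _ _ ⟨
    (c ×× 1# + x * lin cs) + d ×× x ^ suc k   ∎

  lin-0 : ∀ k → lin (Vec.replicate k 0) ≈ 0#
  lin-0 zero    = refl
  lin-0 (suc k) = trans (+-identityˡ _) (trans (*-congˡ (lin-0 k)) (zeroʳ x))

  InSpan : ℕ → Carrier → Set ℓ
  InSpan k a = ∃ λ (cs : Vec ℕ k) → a ≈ lin cs

  span-cong : ∀ {k a b} → a ≈ b → InSpan k b → InSpan k a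
  span-cong a≈b (cs , b≈) = cs , trans a≈b b≈

  span-0 : ∀ k → InSpan k 0#
  span-0 k = Vec.replicate k 0 , sym (lin-0 k)

  span-1 : ∀ k → InSpan (suc k) 1#
  span-1 k = 1 ∷ Vec.replicate k 0 ,
    sym (trans (+-cong (×-homo-1 1#) (trans (*-congˡ (lin-0 k)) (zeroʳ x))) (+-identityʳ 1#))

  span-x : ∀ k → InSpan (suc (suc k)) x
  span-x k with cs , 1≈ ← span-1 k =
    0 ∷ cs , sym (trans (+-identityˡ _) (trans (*-congˡ (sym 1≈)) (*-identityʳ x)))

  span-+ : ∀ {k a b} → InSpan k a → InSpan k b → InSpan k (a + b)
  span-+ (cs , a≈) (ds , b≈) = Vec.zipWith ℕ._+_ cs ds , trans (+-cong a≈ b≈) (lin-+ cs ds)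

  span-× : ∀ {k a} n → InSpan k a → InSpan k (n ×× a)
  span-× {k} zero    _  = span-0 k
  span-×     (suc n) sa = span-+ sa (span-× n sa)

  -- Multiplication by x shifts the coefficients and pushes the top one out to x^(N+1), which folds
  -- back onto x. As N is nonzero, x itself is among the N + 1 spanning powers.
  span-x* : ∀ {N a} {{_ : NonZero N}} → x ^ suc N ≈ x → InSpan (suc N) a → InSpan (suc N) (x * a)
  span-x* {N@(suc N-1)} {a} x^≈x (cs , a≈) with ds , d , eq ← Vec.initLast (0 ∷ cs) = span-cong (begin
      x * a                      ≈⟨ *-congˡ a≈ ⟩
      x * lin cs                 ≈⟨ +-identityˡ _ ⟨
      lin (0 ∷ cs)               ≡⟨ ≡.cong lin eq ⟩
      lin (ds ∷ʳ d)              ≈⟨ lin-∷ʳ ds d ⟩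
      lin ds + d ×× x ^ suc N     ≈⟨ +-congˡ (×-congʳ d x^≈x) ⟩
      lin ds + d ×× x             ∎)
    (span-+ (ds , refl) (span-× d (span-x N-1)))

  module Reduction {p : ℕ} {{_ : NonZero p}} (p×1≈0 : p ×× 1# ≈ 0#) where

    %-×1 : ∀ n → (n % p) ×× 1# ≈ n ×× 1#
    %-×1 n = begin
      (n % p) ×× 1#                                  ≈⟨ +-identityʳ _ ⟨
      (n % p) ×× 1# + 0#                             ≈⟨ +-congˡ (trans (*-congˡ p×1≈0) (zeroʳ _)) ⟨
      (n % p) ×× 1# + ((n / p) ×× 1#) * (p ×× 1#)      ≈⟨ +-congˡ (×1-homo-* (n / p) p) ⟨
      (n % p) ×× 1# + (n / p ℕ.* p) ×× 1#             ≈⟨ ×-homo-+ 1# (n % p) (n / p ℕ.* p) ⟨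
      (n % p ℕ.+ n / p ℕ.* p) ×× 1#                  ≡⟨ ≡.cong (_×× 1#) (m≡m%n+[m/n]*n n p) ⟨
      n ×× 1#                                        ∎

    element : ∀ k → Fin (p ℕ.^ k) → Carrier
    element k i = lin (Vec.map toℕ (toVec k i))

    lin-mod : ∀ {k} (cs : Vec ℕ k) → lin cs ≈ lin (Vec.map toℕ (Vec.map (_mod p) cs))
    lin-mod []       = refl
    lin-mod (c ∷ cs) = +-cong
      (trans (sym (%-×1 c)) (reflexive (≡.cong (_×× 1#) (≡.sym (Fin.toℕ-fromℕ< (m%n<n c p))))))
      (*-congˡ (lin-mod cs))

    span⇒element : ∀ {k a} → InSpan k a → ∃ λ i → a ≈ element k i
    span⇒element {k} (cs , a≈) = fromVec (Vec.map (_mod p) cs) ,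
      trans a≈ (trans (lin-mod cs) (reflexive (≡.cong (λ ds → lin (Vec.map toℕ ds)) (≡.sym (toVec-fromVec (Vec.map (_mod p) cs))))))

-- The algebra 𝔽_p[X]/(X^q - X) acting on sequences

-- Unnormalised expressions suffice: two of them are compared only through their action, in which
-- `X` is the shift and a product is a composition. Induction on expressions then replaces arguments
-- about coefficients.
data Poly : Set where
  𝟘 𝟙 X   : Poly
  _⊕_ _⊗_ : Poly → Poly → Poly

act : Poly → (ℕ → ℕ) → (ℕ → ℕ)
act 𝟘       v j = 0
act 𝟙       v j = v j
act X       v j = v (suc j)
act (a ⊕ b) v j = act a v j ℕ.+ act b v j
act (a ⊗ b) v j = act a (act b v) j

-- Every action is built from shifts, zero and sums, so any additively closed relation is preserved.
-- It serves for equality and for congruence modulo p.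
act-rel : ∀ (_~_ : ℕ → ℕ → Set) → 0 ~ 0 →
  (∀ {k l m n} → k ~ l → m ~ n → (k ℕ.+ m) ~ (l ℕ.+ n)) →
  ∀ a {v w} → (∀ j → v j ~ w j) → ∀ j → act a v j ~ act a w j
act-rel _~_ 0~0 +~+ 𝟘       v~w j = 0~0
act-rel _~_ 0~0 +~+ 𝟙       v~w j = v~w j
act-rel _~_ 0~0 +~+ X       v~w j = v~w (suc j)
act-rel _~_ 0~0 +~+ (a ⊕ b) v~w j = +~+ (act-rel _~_ 0~0 +~+ a v~w j) (act-rel _~_ 0~0 +~+ b v~w j)
act-rel _~_ 0~0 +~+ (a ⊗ b) v~w j = act-rel _~_ 0~0 +~+ a (act-rel _~_ 0~0 +~+ b v~w) j

act-cong : ∀ a {v w} → (∀ j → v j ≡ w j) → ∀ j → act a v j ≡ act a w j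
act-cong = act-rel _≡_ ≡.refl (cong₂ ℕ._+_)

act-0 : ∀ a j → act a (λ _ → 0) j ≡ 0
act-0 𝟘       j = ≡.refl
act-0 𝟙       j = ≡.refl
act-0 X       j = ≡.refl
act-0 (a ⊕ b) j = cong₂ ℕ._+_ (act-0 a j) (act-0 b j)
act-0 (a ⊗ b) j = ≡.trans (act-cong a (act-0 b) j) (act-0 a j)

+-interchange : ∀ a b c d → (a ℕ.+ b) ℕ.+ (c ℕ.+ d) ≡ (a ℕ.+ c) ℕ.+ (b ℕ.+ d)
+-interchange = interchange
  where open import Algebra.Properties.CommutativeSemigroup ℕ.+-commutativeSemigroup

act-+ : ∀ a v w j → act a (λ i → v i ℕ.+ w i) j ≡ act a v j ℕ.+ act a w j
act-+ 𝟘       v w j = ≡.refl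
act-+ 𝟙       v w j = ≡.refl
act-+ X       v w j = ≡.refl
act-+ (a ⊕ b) v w j = ≡.trans (cong₂ ℕ._+_ (act-+ a v w j) (act-+ b v w j))
                            (+-interchange (act a v j) (act a w j) (act b v j) (act b w j))
act-+ (a ⊗ b) v w j = ≡.trans (act-cong a (act-+ b v w) j) (act-+ a (act b v) (act b w) j)

act-shift : ∀ a v j → act a (λ i → v (suc i)) j ≡ act a v (suc j)
act-shift 𝟘       v j = ≡.refl
act-shift 𝟙       v j = ≡.refl
act-shift X       v j = ≡.refl
act-shift (a ⊕ b) v j = cong₂ ℕ._+_ (act-shift a v j) (act-shift b v j)
act-shift (a ⊗ b) v j = ≡.trans (act-cong a (act-shift b v) j) (act-shift a (act b v) j)

-- Each `act b` is additive and commutes with the shift, hence with everything generated from the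
-- shift by sums and compositions.
act-comm : ∀ a b v j → act a (act b v) j ≡ act b (act a v) j
act-comm 𝟘       b v j = ≡.sym (act-0 b j)
act-comm 𝟙       b v j = ≡.refl
act-comm X       b v j = ≡.sym (act-shift b v j)
act-comm (a ⊕ c) b v j = ≡.trans (cong₂ ℕ._+_ (act-comm a b v j) (act-comm c b v j))
                               (≡.sym (act-+ b (act a v) (act c v) j))
act-comm (a ⊗ c) b v j = ≡.trans (act-cong a (act-comm c b v) j) (act-comm a b (act c v) j)

_·_ : ℕ → Poly → Poly
zero  · a = 𝟘
suc n · a = a ⊕ (n · a)

act-· : ∀ n a v j → act (n · a) v j ≡ n ℕ.* act a v j
act-· zero    a v j = ≡.refl
act-· (suc n) a v j = cong (act a v j ℕ.+_) (act-· n a v j)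

-- 𝔽_p[X]/(X^(N+1) − X), realised through its action on v₀ (X is the shift): v₀ has period N from
-- index 1 on and its first nonzero entry at N, so no polynomial of degree at most N annihilates it.
module CyclicAlgebra (p N : ℕ) {{_ : NonZero p}} {{_ : NonZero N}} where

  δ : ℕ → ℕ
  δ zero    = 1
  δ (suc _) = 0

  v₀ : ℕ → ℕ
  -- The value 1 here would make the sequence purely periodic, and X^N - 1 would annihilate it; the
  -- value 0 preserves the factor X of X^(N+1) - X.
  v₀ zero    = 0
  v₀ (suc j) = δ (suc j % N)

  v₀-periodic : ∀ j → v₀ (suc N ℕ.+ j) ≡ v₀ (suc j)
  v₀-periodic j = cong δ (begin
    suc (N ℕ.+ j) % N   ≡⟨ cong (λ k → suc k % N) (ℕ.+-comm N j) ⟩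
    (suc j ℕ.+ N) % N   ≡⟨ [m+n]%n≡m%n (suc j) N ⟩
    suc j % N           ∎)
    where open ≡-Reasoning

  v₀-N : v₀ N ≡ 1
  v₀-N = go N ≡.refl
    where
    go : ∀ n → n ≡ N → v₀ n ≡ 1
    go zero    0≡N = contradiction (≡.sym 0≡N) (ℕ.≢-nonZero⁻¹ N)
    go (suc n) n≡N = cong δ (≡.trans (cong (_% N) n≡N) (n%n≡0 N))

  v₀-<N : ∀ j → j < N → v₀ j ≡ 0
  v₀-<N zero    _   = ≡.refl
  v₀-<N (suc j) j<N = cong δ (m<n⇒m%n≡m j<N)

  _≋_ : ℕ → ℕ → Set
  m ≋ n = m % p ≡ n % p

  ≋-+ : ∀ {k l m n} → k ≋ l → m ≋ n → (k ℕ.+ m) ≋ (l ℕ.+ n)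
  ≋-+ {k} {l} {m} {n} k≋l m≋n = begin
    (k ℕ.+ m) % p             ≡⟨ %-distribˡ-+ k m p ⟩
    (k % p ℕ.+ m % p) % p     ≡⟨ cong₂ (λ a b → (a ℕ.+ b) % p) k≋l m≋n ⟩
    (l % p ℕ.+ n % p) % p     ≡⟨ %-distribˡ-+ l n p ⟨
    (l ℕ.+ n) % p             ∎
    where open ≡-Reasoning

  infix 4 _≈_
  -- Equality modulo the polynomials that annihilate `v₀` modulo p; by commutativity these form an
  -- ideal. The record lets both sides be recovered from the type of a proof.
  record _≈_ (a b : Poly) : Set where
    constructor mk
    field at : ∀ j → act a v₀ j ≋ act b v₀ j
  open _≈_

  mk≡ : ∀ {a b} → (∀ j → act a v₀ j ≡ act b v₀ j) → a ≈ b
  mk≡ eq = mk λ j → cong (_% p) (eq j)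

  -- With natural coefficients, -1 is represented by p - 1.
  neg : Poly → Poly
  neg a = (p ℕ.∸ 1) · a

  p·≈𝟘 : ∀ a → (p · a) ≈ 𝟘
  p·≈𝟘 a = mk λ j → ≡.trans (cong (_% p) (≡.trans (act-· p a v₀ j) (ℕ.*-comm p _)))
                          (≡.trans (m*n%n≡0 (act a v₀ j) p) (≡.sym (m*n%n≡0 0 p)))

  -- `a ≈ b` speaks about `v₀` only, while here the two act on `act d v₀`; commuting d to the
  -- outside brings them back to `v₀`.
  ⊗-cong : ∀ {a b c d} → a ≈ b → c ≈ d → (a ⊗ c) ≈ (b ⊗ d)
  ⊗-cong {a} {b} {c} {d} a≈b c≈d = mk λ j → begin
    act a (act c v₀) j % p   ≡⟨ act-rel _≋_ ≡.refl ≋-+ a (at c≈d) j ⟩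
    act a (act d v₀) j % p   ≡⟨ cong (_% p) (act-comm a d v₀ j) ⟩
    act d (act a v₀) j % p   ≡⟨ act-rel _≋_ ≡.refl ≋-+ d (at a≈b) j ⟩
    act d (act b v₀) j % p   ≡⟨ cong (_% p) (act-comm d b v₀ j) ⟩
    act b (act d v₀) j % p   ∎
    where open ≡-Reasoning

  neg-inverseʳ : ∀ a → (a ⊕ neg a) ≈ 𝟘
  neg-inverseʳ a = ≡.subst (λ k → (k · a) ≈ 𝟘) (≡.sym (ℕ.suc-pred p)) (p·≈𝟘 a)

  ≈-trans : ∀ {a b c} → a ≈ b → b ≈ c → a ≈ c
  ≈-trans (mk f) (mk g) = mk λ j → ≡.trans (f j) (g j)

  ·-cong : ∀ n {a b} → a ≈ b → (n · a) ≈ (n · b)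
  ·-cong zero    a≈b = mk λ _ → ≡.refl
  ·-cong (suc n) a≈b = mk λ j → ≋-+ (at a≈b j) (at (·-cong n a≈b) j)

  isCommutativeRing : IsCommutativeRing _≈_ _⊕_ _⊗_ neg 𝟘 𝟙
  isCommutativeRing = record
    { isRing = record
      { +-isAbelianGroup = record
        { isGroup = record
          { isMonoid = record
            { isSemigroup = record
              { isMagma = record
                { isEquivalence = record
                  { refl  = mk λ _ → ≡.refl
                  ; sym   = λ eq → mk λ j → ≡.sym (at eq j)
                  ; trans = ≈-trans
                  }
                ; ∙-cong = λ p q → mk λ j → ≋-+ (at p j) (at q j)
                }
              ; assoc = λ a b c → mk≡ λ j → ℕ.+-assoc (act a v₀ j) (act b v₀ j) (act c v₀ j)
              }
            ; identity = (λ a → mk λ _ → ≡.refl) , (λ a → mk≡ λ j → ℕ.+-identityʳ (act a v₀ j))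
            }
          ; inverse = (λ a → ≈-trans (mk≡ λ j → ℕ.+-comm (act (neg a) v₀ j) (act a v₀ j)) (neg-inverseʳ a))
                    , neg-inverseʳ
          ; ⁻¹-cong = ·-cong (p ℕ.∸ 1)
          }
        ; comm = λ a b → mk≡ λ j → ℕ.+-comm (act a v₀ j) (act b v₀ j)
        }
      ; *-cong     = ⊗-cong
      ; *-assoc    = λ a b c → mk λ _ → ≡.refl
      ; *-identity = (λ a → mk λ _ → ≡.refl) , (λ a → mk λ _ → ≡.refl)
      ; distrib    = (λ a b c → mk≡ λ j → act-+ a (act b v₀) (act c v₀) j) , (λ a b c → mk λ _ → ≡.refl)
      }
    ; *-comm = λ a b → mk≡ λ j → act-comm a b v₀ j
    }

  commutativeRing : CommutativeRing 0ℓ 0ℓ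
  commutativeRing = record { isCommutativeRing = isCommutativeRing }

  module R = CommutativeRing commutativeRing
  open import Algebra.Properties.Semiring.Exp R.semiring using (_^_)
  open import Algebra.Properties.Semiring.Mult R.semiring using () renaming (_×_ to _××_)

  p×1≈0 : p ×× 𝟙 ≈ 𝟘
  p×1≈0 = ≡.subst (λ a → a ≈ 𝟘) (·≡× p) (p·≈𝟘 𝟙)
    where
    ·≡× : ∀ n → n · 𝟙 ≡ n ×× 𝟙
    ·≡× zero    = ≡.refl
    ·≡× (suc n) = cong (𝟙 ⊕_) (·≡× n)

  act-X^ : ∀ n v j → act (X ^ n) v j ≡ v (n ℕ.+ j)
  act-X^ zero    v j = ≡.refl
  act-X^ (suc n) v j = ≡.trans (act-X^ n v (suc j)) (cong v (ℕ.+-suc n j))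

  X^1+N≈X : X ^ suc N ≈ X
  X^1+N≈X = mk≡ λ j → ≡.trans (act-X^ (suc N) v₀ j) (v₀-periodic j)

  act-periodic : ∀ a j → act a v₀ (suc N ℕ.+ j) ≡ act a v₀ (suc j)
  act-periodic a j = begin
    act a v₀ (suc N ℕ.+ j)         ≡⟨ act-X^ (suc N) (act a v₀) j ⟨
    act (X ^ suc N) (act a v₀) j   ≡⟨ act-comm (X ^ suc N) a v₀ j ⟩
    act a (act (X ^ suc N) v₀) j   ≡⟨ act-cong a (λ i → ≡.trans (act-X^ (suc N) v₀ i) (v₀-periodic i)) j ⟩
    act a (act X v₀) j             ≡⟨ act-comm a X v₀ j ⟩
    act a v₀ (suc j)               ∎
    where open ≡-Reasoning

  -- The indices 0 to N decide: from N + 1 on, `act-periodic` moves an index back by N, and N is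
  -- positive.
  _≈?_ : ∀ a b → Dec (a ≈ b)
  a ≈? b with ℕ.allUpTo? (λ j → act a v₀ j % p ℕ.≟ act b v₀ j % p) (suc N)
  ... | no ¬eq = no λ a≈b → ¬eq (λ {j} _ → at a≈b j)
  ... | yes eq = yes (mk (<-rec (λ j → act a v₀ j ≋ act b v₀ j) step))
    where
    step : ∀ j → (∀ {i} → i < j → act a v₀ i ≋ act b v₀ i) → act a v₀ j ≋ act b v₀ j
    step j rec with suc N ℕ.≤? j
    ... | no  1+N≰j = eq (ℕ.≰⇒> 1+N≰j)
    ... | yes 1+N≤j with k , ≡.refl ← ℕ.m≤n⇒∃[o]m+o≡n 1+N≤j = begin
        act a v₀ (suc N ℕ.+ k) % p   ≡⟨ cong (_% p) (act-periodic a k) ⟩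
        act a v₀ (suc k) % p         ≡⟨ rec (s≤s (ℕ.m<n+m k (ℕ.>-nonZero⁻¹ N))) ⟩
        act b v₀ (suc k) % p         ≡⟨ cong (_% p) (act-periodic b k) ⟨
        act b v₀ (suc N ℕ.+ k) % p   ∎
        where open ≡-Reasoning

  -- A monic polynomial of degree d moves the first nonzero entry d places to the left.
  Monic : ℕ → Poly → Set
  Monic d a = ∀ M v → (∀ j → j < d ℕ.+ M → v j ≡ 0) →
    (∀ j → j < M → act a v j ≡ 0) × act a v M ≡ v (d ℕ.+ M)

  monic-𝟙 : Monic 0 𝟙
  monic-𝟙 M v v≡0 = v≡0 , ≡.refl

  monic-⊗ : ∀ {d e a b} → Monic d a → Monic e b → Monic (d ℕ.+ e) (a ⊗ b)
  monic-⊗ {d} {e} {a} {b} ma mb M v v≡0 with mb (d ℕ.+ M) v (≡.subst (λ k → ∀ j → j < k → v j ≡ 0) d+e v≡0)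
    where
    d+e : (d ℕ.+ e) ℕ.+ M ≡ e ℕ.+ (d ℕ.+ M)
    d+e = ≡.trans (cong (ℕ._+ M) (ℕ.+-comm d e)) (ℕ.+-assoc e d M)
  ... | bv≡0 , bv≡v with ma M (act b v) bv≡0
  ...   | abv≡0 , abv≡bv = abv≡0 , ≡.trans abv≡bv (≡.trans bv≡v (cong v (≡.sym (≡.trans (cong (ℕ._+ M) (ℕ.+-comm d e)) (ℕ.+-assoc e d M)))))

  -- The term -X looks one place ahead. For 1 < d this stays inside the zero stretch of v at all
  -- indices up to M, so only X^d contributes there.
  monic-X^-X : ∀ d → 1 < d → Monic d ((X ^ d) ⊕ neg X)
  monic-X^-X d 1<d M v v≡0 = below , ≡.trans (cong₂ ℕ._+_ (act-X^ d v M) (negX M ℕ.≤-refl)) (ℕ.+-identityʳ _)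
    where
    negX : ∀ j → j ≤ M → act (neg X) v j ≡ 0
    negX j j≤M = ≡.trans (act-· (p ℕ.∸ 1) X v j)
      (≡.trans (cong ((p ℕ.∸ 1) ℕ.*_) (v≡0 (suc j) (ℕ.+-mono-≤ 1<d j≤M))) (ℕ.*-zeroʳ (p ℕ.∸ 1)))
    below : ∀ j → j < M → act ((X ^ d) ⊕ neg X) v j ≡ 0
    below j j<M = cong₂ ℕ._+_ (≡.trans (act-X^ d v j) (v≡0 _ (ℕ.+-monoʳ-< d j<M))) (negX j (ℕ.<⇒≤ j<M))

  -- At index N - d the action reads off the entry 1 of `v₀` at N, and 1 is nonzero modulo p.
  monic≉0 : 1 < p → ∀ {d a} → Monic d a → d ≤ N → ¬ a ≈ 𝟘
  monic≉0 1<p {d} {a} ma d≤N a≈0 with k , ≡.refl ← ℕ.m≤n⇒∃[o]m+o≡n d≤N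
    with _ , av≡1 ← ma k v₀ v₀-<N = contradiction 1≡0 λ ()
    where
    open ≡-Reasoning
    1≡0 : 1 ≡ 0
    1≡0 = begin
      1               ≡⟨ m<n⇒m%n≡m 1<p ⟨
      1 % p           ≡⟨ cong (_% p) (≡.trans av≡1 v₀-N) ⟨
      act a v₀ k % p  ≡⟨ at a≈0 k ⟩
      0 % p           ≡⟨ m*n%n≡0 0 p ⟩
      0               ∎

-- Primitive idempotents and their components

module PrimitiveIdempotents {c ℓ} (R : CommutativeRing c ℓ) where

  open CommutativeRing R
  open Algebra.Properties.CommutativeSemiring.Exp commutativeSemiring
  open Algebra.Solver.Ring.NaturalCoefficients.Default commutativeSemiring
  open import Relation.Binary.Reasoning.Setoid setoid

  module Existence
    (_≈?_ : ∀ a b → Dec (a ≈ b))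
    {N} (enum : Fin N → Carrier) (index : ∀ a → ∃ λ i → a ≈ enum i)
    (k : ℕ) (a^[2+k]≈a : ∀ a → a ^ suc (suc k) ≈ a) where

    idempotent : Carrier → Carrier
    idempotent a = a ^ suc k

    idempotent-* : ∀ a → idempotent a * idempotent a ≈ idempotent a
    idempotent-* a = begin
      (a * a ^ k) * (a * a ^ k)  ≈⟨ solve 2 (λ a b → (a :* b) :* (a :* b) := (a :* (a :* b)) :* b) refl a (a ^ k) ⟩
      (a * (a * a ^ k)) * a ^ k  ≈⟨ *-congʳ (a^[2+k]≈a a) ⟩
      a * a ^ k                  ∎

    idempotent≈0⇒≈0 : ∀ a → idempotent a ≈ 0# → a ≈ 0#
    idempotent≈0⇒≈0 a e≈0 = trans (sym (a^[2+k]≈a a)) (trans (*-congˡ e≈0) (zeroʳ a))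

    -- `minimal` ranges over all ring elements through the idempotents they generate below e. This
    -- is the form that yields inverses: either a * e vanishes or one of its powers is e.
    record Primitive (e : Carrier) : Set (c ⊔ ℓ) where
      field
        idem    : e * e ≈ e
        e≉0     : ¬ e ≈ 0#
        minimal : ∀ a → idempotent (a * e) ≈ 0# ⊎ idempotent (a * e) ≈ e

    -- The usual strict order of idempotents, moved to indices so that finiteness makes it well
    -- founded. Its order laws hold without idempotence, so all indices may be included.
    _⊏_ : Fin N → Fin N → Set ℓ
    i ⊏ j = (enum i * enum j ≈ enum i) × ¬ (enum i ≈ enum j)

    ⊏-isStrictPartialOrder : IsStrictPartialOrder _≡_ _⊏_
    ⊏-isStrictPartialOrder = record
      { isEquivalence = ≡.isEquivalence
      ; irrefl        = λ { ≡.refl (_ , i≉i) → i≉i refl }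
      ; trans         = ⊏-trans
      ; <-resp-≈      = (λ { ≡.refl i⊏j → i⊏j }) , (λ { ≡.refl i⊏j → i⊏j })
      }
      where
      ⊏-trans : ∀ {i j l} → i ⊏ j → j ⊏ l → i ⊏ l
      ⊏-trans {i} {j} {l} (ij≈i , i≉j) (jl≈j , j≉l) = il≈i , λ i≈l → j≉l (begin
          enum j            ≈⟨ jl≈j ⟨
          enum j * enum l   ≈⟨ *-congˡ i≈l ⟨
          enum j * enum i   ≈⟨ *-comm _ _ ⟩
          enum i * enum j   ≈⟨ ij≈i ⟩
          enum i            ≈⟨ i≈l ⟩
          enum l            ∎)
        where
        il≈i : enum i * enum l ≈ enum i
        il≈i = begin
          enum i * enum l              ≈⟨ *-congʳ ij≈i ⟨
          (enum i * enum j) * enum l   ≈⟨ *-assoc _ _ _ ⟩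
          enum i * (enum j * enum l)   ≈⟨ *-congˡ jl≈j ⟩
          enum i * enum j              ≈⟨ ij≈i ⟩
          enum i                       ∎

    -- Descent along `⊏`: a finite search either finds an element whose idempotent below e is
    -- neither 0 nor e, and continues from there, or certifies that e is primitive.
    primitive-below : ∀ e → e * e ≈ e → ¬ e ≈ 0# → ∃ λ f → Primitive f × f * e ≈ f
    primitive-below e ee≈e e≉0 with i , e≈i ← index e = go i (spo-wellFounded ⊏-isStrictPartialOrder i) e e≈i ee≈e e≉0
      where
      go : ∀ i → Acc _⊏_ i → ∀ e → e ≈ enum i → e * e ≈ e → ¬ e ≈ 0# → ∃ λ f → Primitive f × f * e ≈ f
      go i (acc rec) e e≈i ee≈e e≉0
        with Fin.any? (λ j → ¬? (idempotent (enum j * e) ≈? 0#) ×-dec ¬? (idempotent (enum j * e) ≈? e))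
      ... | no ¬smaller = e , record { idem = ee≈e ; e≉0 = e≉0 ; minimal = minimal } , ee≈e
        where
        minimal : ∀ a → idempotent (a * e) ≈ 0# ⊎ idempotent (a * e) ≈ e
        minimal a with j , a≈j ← index a with idempotent (enum j * e) ≈? 0# | idempotent (enum j * e) ≈? e
        ... | yes f≈0 | _       = inj₁ (trans (^-congˡ (suc k) (*-congʳ a≈j)) f≈0)
        ... | no _    | yes f≈e = inj₂ (trans (^-congˡ (suc k) (*-congʳ a≈j)) f≈e)
        ... | no f≉0  | no f≉e  = contradiction (j , f≉0 , f≉e) ¬smaller
      ... | yes (j , f≉0 , f≉e) = below
        where
        f = idempotent (enum j * e)
        fe≈f : f * e ≈ f
        fe≈f = begin
          ((enum j * e) * b) * e   ≈⟨ solve 3 (λ a e b → ((a :* e) :* b) :* e := (a :* (e :* e)) :* b) refl (enum j) e b ⟩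
          (enum j * (e * e)) * b   ≈⟨ *-congʳ (*-congˡ ee≈e) ⟩
          (enum j * e) * b         ∎
          where b = (enum j * e) ^ k
        below : ∃ λ g → Primitive g × g * e ≈ g
        below with l , f≈l ← index f
          with g , prim , gf≈g ← go l (rec ((begin
                 enum l * enum i   ≈⟨ *-cong f≈l e≈i ⟨
                 f * e             ≈⟨ fe≈f ⟩
                 f                 ≈⟨ f≈l ⟩
                 enum l            ∎) , λ l≈i → f≉e (trans f≈l (trans l≈i (sym e≈i))))) f f≈l (idempotent-* (enum j * e)) f≉0
          = g , prim , (begin
              g * e         ≈⟨ *-congʳ gf≈g ⟨
              (g * f) * e   ≈⟨ *-assoc _ _ _ ⟩
              g * (f * e)   ≈⟨ *-congˡ fe≈f ⟩
              g * f         ≈⟨ gf≈g ⟩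
              g             ∎)

-- R e ≅ R / (1 − e): multiplication by e turns the quotient into a change of equality.
module Localisation {c ℓ} (R : CommutativeRing c ℓ) (e : CommutativeRing.Carrier R) where

  open CommutativeRing R
  open import Relation.Binary.Reasoning.Setoid setoid

  infix 4 _~_
  record _~_ (a b : Carrier) : Set ℓ where
    constructor mk
    field at : a * e ≈ b * e
  open _~_ public

  ~-cong : ∀ {a b} → a ≈ b → a ~ b
  ~-cong a≈b = mk (*-congʳ a≈b)

  ~-trans : ∀ {a b c} → a ~ b → b ~ c → a ~ c
  ~-trans (mk p) (mk q) = mk (trans p q)

  ~-+ : ∀ {a b c d} → a ~ b → c ~ d → a + c ~ b + d
  ~-+ (mk p) (mk q) = mk (trans (distribʳ e _ _) (trans (+-cong p q) (sym (distribʳ e _ _))))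

  ~-*ʳ : ∀ {a b} c → a ~ b → a * c ~ b * c
  ~-*ʳ {a} {b} c (mk p) = mk (begin
    (a * c) * e   ≈⟨ trans (*-assoc a c e) (trans (*-congˡ (*-comm c e)) (sym (*-assoc a e c))) ⟩
    (a * e) * c   ≈⟨ *-congʳ p ⟩
    (b * e) * c   ≈⟨ trans (*-assoc b e c) (trans (*-congˡ (*-comm e c)) (sym (*-assoc b c e))) ⟩
    (b * c) * e   ∎)

  ~-* : ∀ {a b c d} → a ~ b → c ~ d → a * c ~ b * d
  ~-* {a} {b} {c} {d} p q = ~-trans (~-*ʳ c p) (~-trans (~-cong (*-comm b c)) (~-trans (~-*ʳ b q) (~-cong (*-comm d b))))

  ~-neg : ∀ {a b} → a ~ b → - a ~ - b
  ~-neg {a} {b} p = ~-trans (~-cong (sym (-1*x≈-x a))) (~-trans (~-* (mk refl) p) (~-cong (-1*x≈-x b)))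
    where open import Algebra.Properties.Ring ring using (-1*x≈-x)

  isCommutativeRing′ : IsCommutativeRing _~_ _+_ _*_ -_ 0# 1#
  isCommutativeRing′ = record
    { isRing = record
      { +-isAbelianGroup = record
        { isGroup = record
          { isMonoid = record
            { isSemigroup = record
              { isMagma = record
                { isEquivalence = record { refl = mk refl ; sym = λ p → mk (sym (at p)) ; trans = ~-trans }
                ; ∙-cong = ~-+
                }
              ; assoc = λ a b c → ~-cong (+-assoc a b c)
              }
            ; identity = (λ a → ~-cong (+-identityˡ a)) , (λ a → ~-cong (+-identityʳ a))
            }
          ; inverse = (λ a → ~-cong (-‿inverseˡ a)) , (λ a → ~-cong (-‿inverseʳ a))
          ; ⁻¹-cong = ~-neg
          }
        ; comm = λ a b → ~-cong (+-comm a b)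
        }
      ; *-cong     = ~-*
      ; *-assoc    = λ a b c → ~-cong (*-assoc a b c)
      ; *-identity = (λ a → ~-cong (*-identityˡ a)) , (λ a → ~-cong (*-identityʳ a))
      ; distrib    = (λ a b c → ~-cong (distribˡ a b c)) , (λ a b c → ~-cong (distribʳ a b c))
      }
    ; *-comm = λ a b → ~-cong (*-comm a b)
    }

  localisation : CommutativeRing c ℓ
  localisation = record { isCommutativeRing = isCommutativeRing′ }

  private
    module L = CommutativeRing localisation
    module R^ = Algebra.Properties.CommutativeSemiring.Exp commutativeSemiring
    module L^ = Algebra.Properties.CommutativeSemiring.Exp L.commutativeSemiring
    module R× = Algebra.Properties.Semiring.Mult semiring
    module L× = Algebra.Properties.Semiring.Mult L.semiring

  ^-localisation : ∀ a n → a L^.^ n ≡ a R^.^ n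
  ^-localisation a zero    = ≡.refl
  ^-localisation a (suc n) = ≡.cong (a *_) (^-localisation a n)

  ×-localisation : ∀ n a → n L×.× a ≡ n R×.× a
  ×-localisation zero    a = ≡.refl
  ×-localisation (suc n) a = ≡.cong (a +_) (×-localisation n a)

-- Finite fields and the number of their elements

record FiniteField (q : ℕ) : Set₁ where
  field
    commutativeRing : CommutativeRing 0ℓ 0ℓ
  open CommutativeRing commutativeRing public
  infix 4 _≈?_
  field
    _≈?_           : ∀ a b → Dec (a ≈ b)
    1≉0            : ¬ 1# ≈ 0#
    inverse        : ∀ a → ¬ a ≈ 0# → ∃ λ b → a * b ≈ 1#
    enum           : Fin q → Carrier
    enum-injective : ∀ i j → enum i ≈ enum j → i ≡ j
    index          : ∀ a → ∃ λ i → a ≈ enum i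

-- The sum lies strictly between 0 and 2p, so p is the only multiple it can be.
p∣c+[p∸d]⇒c≡d : ∀ {p} (c d : Fin p) → p ∣ toℕ c ℕ.+ (p ∸ toℕ d) → c ≡ d
p∣c+[p∸d]⇒c≡d {p} c d (divides zero eq) =
  contradiction (ℕ.m+n≡0⇒n≡0 (toℕ c) eq) (ℕ.m>n⇒m∸n≢0 (Fin.toℕ<n d))
p∣c+[p∸d]⇒c≡d {p} c d (divides 1 eq) = Fin.toℕ-injective (ℕ.+-cancelʳ-≡ (p ∸ toℕ d) (toℕ c) (toℕ d)
  (≡.trans eq (≡.trans (ℕ.+-identityʳ p) (≡.sym (ℕ.m+[n∸m]≡n (Fin.toℕ≤n d))))))
p∣c+[p∸d]⇒c≡d {p} c d (divides (suc (suc k)) eq) = contradiction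
  (ℕ.≤-trans (ℕ.+-monoʳ-≤ p (ℕ.m≤m+n p (k ℕ.* p))) (ℕ.≤-reflexive (≡.sym eq)))
  (ℕ.<⇒≱ (ℕ.+-mono-<-≤ (Fin.toℕ<n c) (ℕ.m∸n≤m p (toℕ d))))

-- An element with m distinct conjugates x^(p^i) has degree at least m over the prime field.
module Cardinality (K : CommutativeRing 0ℓ 0ℓ) where

  open CommutativeRing K
  open Algebra.Properties.Semiring.Mult semiring using (×1-homo-*) renaming (_×_ to _××_)
  open Algebra.Properties.CommutativeSemiring.Exp commutativeSemiring
  open Polynomials K
  open import Relation.Binary.Reasoning.Setoid setoid

  module Count
    (_≈?_ : ∀ a b → Dec (a ≈ b)) (1≉0 : ¬ 1# ≈ 0#)
    (inverse : ∀ a → ¬ a ≈ 0# → ∃ λ b → a * b ≈ 1#)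
    {p} (pp : Prime p) (p×1≈0 : p ×× 1# ≈ 0#)
    {m k} (p^m≡2+k : p ℕ.^ m ≡ suc (suc k)) (a^q≈a : ∀ a → a ^ (p ℕ.^ m) ≈ a)
    (x : Carrier) (x^≉x : ∀ d → 0 < d → d < m → ¬ x ^ (p ℕ.^ d) ≈ x) where

    instance _ = prime⇒nonZero pp
    open LinearSpan K x
    open Reduction {p} p×1≈0
    open Frobenius.Characteristic K pp p×1≈0

    domain : ∀ a b → a * b ≈ 0# → a ≈ 0# ⊎ b ≈ 0#
    domain a b ab≈0 with a ≈? 0#
    ... | yes a≈0 = inj₁ a≈0
    ... | no  a≉0 with c , ac≈1 ← inverse a a≉0 = inj₂ (begin
      b             ≈⟨ *-identityˡ b ⟨
      1# * b        ≈⟨ *-congʳ ac≈1 ⟨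
      (a * c) * b   ≈⟨ trans (*-congʳ (*-comm a c)) (*-assoc c a b) ⟩
      c * (a * b)   ≈⟨ *-congˡ ab≈0 ⟩
      c * 0#        ≈⟨ zeroʳ c ⟩
      0#            ∎)

    open Roots domain

    multiple×1≈0 : ∀ l n → n ×× 1# ≈ 0# → (l ℕ.* n) ×× 1# ≈ 0#
    multiple×1≈0 l n n×1≈0 = trans (×1-homo-* l n) (trans (*-congˡ n×1≈0) (zeroʳ _))

    ¬multiples-adjacent : ∀ a b {m n} → m ×× 1# ≈ 0# → n ×× 1# ≈ 0# → ¬ 1 ℕ.+ a ℕ.* m ≡ b ℕ.* n
    ¬multiples-adjacent a b {m} {n} m≈0 n≈0 eq = 1≉0 (begin
      1#                              ≈⟨ +-identityʳ 1# ⟨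
      1# + 0#                         ≈⟨ +-congˡ (multiple×1≈0 a m m≈0) ⟨
      (1 ℕ.+ a ℕ.* m) ×× 1#           ≡⟨ ≡.cong (_×× 1#) eq ⟩
      (b ℕ.* n) ×× 1#                 ≈⟨ multiple×1≈0 b n n≈0 ⟩
      0#                              ∎)

    -- A nonzero remainder modulo p is coprime to p. The Bézout identity would then give two
    -- multiples differing by 1 that both vanish in the field.
    ×1≈0⇒∣ : ∀ n → n ×× 1# ≈ 0# → p ∣ n
    ×1≈0⇒∣ n n≈0 with n % p in eq
    ... | zero  = m%n≡0⇒n∣m n p eq
    ... | suc r with coprime-Bézout (prime⇒coprime pp (≡.subst (_< p) eq (m%n<n n p)))
    ...   | Bézout.+- a b eq′ = contradiction eq′ (¬multiples-adjacent b a r≈0 p×1≈0)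
      where r≈0 = trans (reflexive (≡.cong (_×× 1#) (≡.sym eq))) (trans (%-×1 n) n≈0)
    ...   | Bézout.-+ a b eq′ = contradiction eq′ (¬multiples-adjacent a b p×1≈0 r≈0)
      where r≈0 = trans (reflexive (≡.cong (_×× 1#) (≡.sym eq))) (trans (%-×1 n) n≈0)

    1^n≈1 : ∀ n → 1# ^ n ≈ 1#
    1^n≈1 zero    = refl
    1^n≈1 (suc n) = trans (*-identityˡ _) (1^n≈1 n)

    0^p^d≈0 : ∀ d → 0# ^ (p ℕ.^ d) ≈ 0#
    0^p^d≈0 d with p ℕ.^ d | ℕ.m^n>0 p d
    ... | suc n | _ = zeroˡ _

    frobenius-fixes-×1 : ∀ d n → (n ×× 1#) ^ (p ℕ.^ d) ≈ n ×× 1#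
    frobenius-fixes-×1 d zero    = 0^p^d≈0 d
    frobenius-fixes-×1 d (suc n) = trans (frobenius^-+ d 1# _) (+-cong (1^n≈1 (p ℕ.^ d)) (frobenius-fixes-×1 d n))

    -- Frobenius is a ring map fixing the multiples of 1, so f(x^(p^d)) = f(x)^(p^d): the conjugates
    -- of a root are roots.
    lin-conjugate : ∀ d {l} (cs : Vec ℕ l) →
      eval (Vec.map (_×× 1#) cs) (x ^ (p ℕ.^ d)) ≈ lin cs ^ (p ℕ.^ d)
    lin-conjugate d []       = sym (0^p^d≈0 d)
    lin-conjugate d (c ∷ cs) = begin
      c ×× 1# + x ^ (p ℕ.^ d) * eval (Vec.map (_×× 1#) cs) (x ^ (p ℕ.^ d))
        ≈⟨ +-cong (sym (frobenius-fixes-×1 d c)) (*-congˡ (lin-conjugate d cs)) ⟩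
      (c ×× 1#) ^ (p ℕ.^ d) + x ^ (p ℕ.^ d) * lin cs ^ (p ℕ.^ d)
        ≈⟨ +-congˡ (^-distrib-* x (lin cs) (p ℕ.^ d)) ⟨
      (c ×× 1#) ^ (p ℕ.^ d) + (x * lin cs) ^ (p ℕ.^ d)
        ≈⟨ frobenius^-+ d _ _ ⟨
      (c ×× 1# + x * lin cs) ^ (p ℕ.^ d) ∎

    -- A further p^(m-d)-th power completes the exponent to p^m, which acts as the identity.
    frobenius-injective : ∀ d {a b} → d ≤ m → a ^ (p ℕ.^ d) ≈ b ^ (p ℕ.^ d) → a ≈ b
    frobenius-injective d {a} {b} d≤m eq = begin
      a                                          ≈⟨ back a ⟨
      (a ^ (p ℕ.^ d)) ^ (p ℕ.^ (m ∸ d))          ≈⟨ ^-congˡ (p ℕ.^ (m ∸ d)) eq ⟩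
      (b ^ (p ℕ.^ d)) ^ (p ℕ.^ (m ∸ d))          ≈⟨ back b ⟩
      b                                          ∎
      where
      back : ∀ a → (a ^ (p ℕ.^ d)) ^ (p ℕ.^ (m ∸ d)) ≈ a
      back a = begin
        (a ^ (p ℕ.^ d)) ^ (p ℕ.^ (m ∸ d))   ≈⟨ ^-assocʳ a (p ℕ.^ d) (p ℕ.^ (m ∸ d)) ⟩
        a ^ (p ℕ.^ d ℕ.* p ℕ.^ (m ∸ d))     ≡⟨ ≡.cong (a ^_) (ℕ.^-distribˡ-+-* p d (m ∸ d)) ⟨
        a ^ (p ℕ.^ (d ℕ.+ (m ∸ d)))         ≡⟨ ≡.cong (λ n → a ^ (p ℕ.^ n)) (ℕ.m+[n∸m]≡n d≤m) ⟩
        a ^ (p ℕ.^ m)                       ≈⟨ a^q≈a a ⟩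
        a                                   ∎

    conjugate : Fin m → Carrier
    conjugate i = x ^ (p ℕ.^ toℕ i)

    -- Writing x^(p^j) as the p^i-th power of x^(p^(j-i)) and cancelling Frobenius makes x equal to
    -- a proper conjugate of itself.
    conjugate-< : ∀ i j → toℕ i < toℕ j → ¬ conjugate i ≈ conjugate j
    conjugate-< i j i<j eq = x^≉x (toℕ j ∸ toℕ i) (ℕ.m<n⇒0<n∸m i<j) (ℕ.≤-<-trans (ℕ.m∸n≤m (toℕ j) (toℕ i)) (Fin.toℕ<n j))
      (sym (frobenius-injective (toℕ i) (Fin.toℕ≤n i) (begin
        x ^ (p ℕ.^ toℕ i)
          ≈⟨ eq ⟩
        x ^ (p ℕ.^ toℕ j)
          ≡⟨ ≡.cong (λ n → x ^ (p ℕ.^ n)) (ℕ.m∸n+n≡m (ℕ.<⇒≤ i<j)) ⟨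
        x ^ (p ℕ.^ (toℕ j ∸ toℕ i ℕ.+ toℕ i))
          ≡⟨ ≡.cong (x ^_) (ℕ.^-distribˡ-+-* p (toℕ j ∸ toℕ i) (toℕ i)) ⟩
        x ^ (p ℕ.^ (toℕ j ∸ toℕ i) ℕ.* p ℕ.^ toℕ i)
          ≈⟨ ^-assocʳ x (p ℕ.^ (toℕ j ∸ toℕ i)) (p ℕ.^ toℕ i) ⟨
        (x ^ (p ℕ.^ (toℕ j ∸ toℕ i))) ^ (p ℕ.^ toℕ i) ∎)))

    conjugate-injective : ∀ i j → conjugate i ≈ conjugate j → i ≡ j
    conjugate-injective i j eq with ℕ.<-cmp (toℕ i) (toℕ j)
    ... | tri< i<j _ _ = contradiction eq (conjugate-< i j i<j)
    ... | tri≈ _ i≡j _ = Fin.toℕ-injective i≡j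
    ... | tri> _ _ j<i = contradiction (sym eq) (conjugate-< j i j<i)

    -- If a polynomial with m coefficients kills x, it kills all m distinct conjugates, and is
    -- therefore zero.
    lin≈0⇒∣ : (cs : Vec ℕ m) → lin cs ≈ 0# → All (p ∣_) cs
    lin≈0⇒∣ cs lin≈0 = unmap cs (roots⇒≈0 (Vec.map (_×× 1#) cs) conjugate conjugate-injective λ i →
        trans (lin-conjugate (toℕ i) cs) (trans (^-congˡ (p ℕ.^ toℕ i) lin≈0) (0^p^d≈0 (toℕ i))))
      where
      unmap : ∀ {l} (cs : Vec ℕ l) → All (_≈ 0#) (Vec.map (_×× 1#) cs) → All (p ∣_) cs
      unmap []       []         = []
      unmap (c ∷ cs) (c≈0 ∷ cs≈0) = ×1≈0⇒∣ c c≈0 ∷ unmap cs cs≈0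

    difference : ∀ {l} → Vec (Fin p) l → Vec (Fin p) l → Vec ℕ l
    difference cs ds = Vec.zipWith ℕ._+_ (Vec.map toℕ cs) (Vec.map (λ d → p ∸ toℕ d) ds)

    difference≈0 : ∀ {l} (ds : Vec (Fin p) l) → lin (difference ds ds) ≈ 0#
    difference≈0 []       = refl
    difference≈0 (d ∷ ds) = begin
      (toℕ d ℕ.+ (p ∸ toℕ d)) ×× 1# + x * lin (difference ds ds)
        ≈⟨ +-cong (reflexive (≡.cong (_×× 1#) (ℕ.m+[n∸m]≡n (Fin.toℕ≤n d)))) (*-congˡ (difference≈0 ds)) ⟩
      p ×× 1# + x * 0#
        ≈⟨ +-cong p×1≈0 (zeroʳ x) ⟩
      0# + 0#
        ≈⟨ +-identityˡ 0# ⟩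
      0# ∎

    element-injective : ∀ i j → element m i ≈ element m j → i ≡ j
    element-injective i j eq = toVec-injective m (digits≡ (toVec m i) (toVec m j) (lin≈0⇒∣ _ (begin
        lin (difference (toVec m i) (toVec m j))   ≈⟨ lin-+ (Vec.map toℕ (toVec m i)) _ ⟨
        element m i + lin js                       ≈⟨ +-congʳ eq ⟩
        element m j + lin js                       ≈⟨ lin-+ (Vec.map toℕ (toVec m j)) _ ⟩
        lin (difference (toVec m j) (toVec m j))   ≈⟨ difference≈0 (toVec m j) ⟩
        0#                                         ∎)))
      where
      js = Vec.map (λ d → p ∸ toℕ d) (toVec m j)
      digits≡ : ∀ {l} (cs ds : Vec (Fin p) l) → All (p ∣_) (difference cs ds) → cs ≡ ds
      digits≡ []       []       []          = ≡.refl
      digits≡ (c ∷ cs) (d ∷ ds) (p∣ ∷ p∣s) = ≡.cong₂ _∷_ (p∣c+[p∸d]⇒c≡d c d p∣) (digits≡ cs ds p∣s)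

    -- Writing q as k + 2 exposes the coefficients 0 and -1 in front of the leading part X^k.
    X^q-X : Vec Carrier (suc (p ℕ.^ m))
    X^q-X = ≡.subst (λ n → Vec Carrier (suc n)) (≡.sym p^m≡2+k) (0# ∷ - 1# ∷ monomial k)

    eval-X^q-X : ∀ a → eval X^q-X a ≈ 0#
    eval-X^q-X a = begin
      eval X^q-X a                                  ≡⟨ eval-subst (≡.sym p^m≡2+k) (0# ∷ - 1# ∷ monomial k) ⟩
      0# + a * (- 1# + a * eval (monomial k) a)     ≈⟨ +-identityˡ _ ⟩
      a * (- 1# + a * eval (monomial k) a)          ≈⟨ *-congˡ (+-congˡ (*-congˡ (eval-monomial k a))) ⟩
      a * (- 1# + a * a ^ k)                        ≈⟨ distribˡ a (- 1#) _ ⟩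
      a * - 1# + a ^ suc (suc k)                    ≈⟨ +-cong (trans (*-comm a (- 1#)) (-1*x≈-x a)) (trans (^-congʳ a (≡.sym p^m≡2+k)) (a^q≈a a)) ⟩
      - a + a                                       ≈⟨ -‿inverseˡ a ⟩
      0#                                            ∎
      where
      open Algebra.Properties.Ring ring using (-1*x≈-x)
      eval-subst : ∀ {n l} (eq : n ≡ l) (f : Vec Carrier (suc n)) → eval (≡.subst (λ n → Vec Carrier (suc n)) eq f) a ≡ eval f a
      eval-subst ≡.refl f = ≡.refl

    X^q-X≉0 : ¬ All (_≈ 0#) X^q-X
    X^q-X≉0 all = 1≉0 (monomial≉0 k (All.tail (All.tail (unsubst (≡.sym p^m≡2+k) (0# ∷ - 1# ∷ monomial k) all))))
      where
      unsubst : ∀ {n l} (eq : n ≡ l) (f : Vec Carrier (suc n)) →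
        All (_≈ 0#) (≡.subst (λ n → Vec Carrier (suc n)) eq f) → All (_≈ 0#) f
      unsubst ≡.refl f all = all

    -- An element outside the list, together with the p^m distinct listed ones, would give p^m + 1
    -- roots of `X^q-X`.
    element-surjective : ∀ a → ∃ λ i → a ≈ element m i
    element-surjective a with Fin.any? (λ i → a ≈? element m i)
    ... | yes found = found
    ... | no ¬found = contradiction (roots⇒≈0 X^q-X ρ ρ-injective (λ i → eval-X^q-X (ρ i))) X^q-X≉0
      where
      ρ : Fin (suc (p ℕ.^ m)) → Carrier
      ρ Fin.zero    = a
      ρ (Fin.suc i) = element m i
      ρ-injective : ∀ i j → ρ i ≈ ρ j → i ≡ j
      ρ-injective Fin.zero    Fin.zero    _  = ≡.refl
      ρ-injective Fin.zero    (Fin.suc j) eq = contradiction (j , eq) ¬found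
      ρ-injective (Fin.suc i) Fin.zero    eq = contradiction (i , sym eq) ¬found
      ρ-injective (Fin.suc i) (Fin.suc j) eq = ≡.cong Fin.suc (element-injective i j eq)

    finiteField : FiniteField (p ℕ.^ m)
    finiteField = record
      { commutativeRing = K
      ; _≈?_            = _≈?_
      ; 1≉0             = 1≉0
      ; inverse         = inverse
      ; enum            = element m
      ; enum-injective  = element-injective
      ; index           = element-surjective
      }

-- A residue field with q elements

module ConjugateProduct (A : CommutativeRing 0ℓ 0ℓ) (p : ℕ) (x : CommutativeRing.Carrier A) where

  open CommutativeRing A
  open Algebra.Properties.CommutativeSemiring.Exp commutativeSemiring using (_^_)
  open import Relation.Binary.Reasoning.Setoid setoid

  -- The shift to suc d leaves out the trivial conjugate, so the product up to m covers the
  -- exponents 1 to m that matter for a field of size p^(m+1).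
  factor : ℕ → Carrier
  factor d = x ^ (p ℕ.^ suc d) - x

  conjugateProduct : ℕ → Carrier
  conjugateProduct zero    = 1#
  conjugateProduct (suc d) = conjugateProduct d * factor d

  factor*e≈0⇒product*e≈0 : ∀ d m e → d < m → factor d * e ≈ 0# → conjugateProduct m * e ≈ 0#
  factor*e≈0⇒product*e≈0 d (suc m) e d<1+m z≈0 with ℕ.m≤n⇒m<n∨m≡n (ℕ.s≤s⁻¹ d<1+m)
  ... | inj₂ ≡.refl = trans (*-assoc _ _ e) (trans (*-congˡ z≈0) (zeroʳ _))
  ... | inj₁ d<m    = begin
    (conjugateProduct m * factor m) * e   ≈⟨ trans (*-congʳ (*-comm _ (factor m))) (*-assoc (factor m) _ e) ⟩
    factor m * (conjugateProduct m * e)   ≈⟨ *-congˡ (factor*e≈0⇒product*e≈0 d m e d<m z≈0) ⟩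
    factor m * 0#                         ≈⟨ zeroʳ (factor m) ⟩
    0#                                    ∎

module ResidueField (A : CommutativeRing 0ℓ 0ℓ) where

  open CommutativeRing A
  open Algebra.Properties.Semiring.Mult semiring using () renaming (_×_ to _××_)
  open Algebra.Properties.CommutativeSemiring.Exp commutativeSemiring
  open import Relation.Binary.Reasoning.Setoid setoid

  module Existence
    (_≈?_ : ∀ a b → Dec (a ≈ b))
    {N} (enum : Fin N → Carrier) (index : ∀ a → ∃ λ i → a ≈ enum i)
    {p} (pp : Prime p) (p×1≈0 : p ×× 1# ≈ 0#)
    {m k} (q≡2+k : p ℕ.^ suc m ≡ suc (suc k)) (a^q≈a : ∀ a → a ^ (p ℕ.^ suc m) ≈ a)
    (x : Carrier) (u≉0 : ¬ ConjugateProduct.conjugateProduct A p x m ≈ 0#) where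

    open ConjugateProduct A p x
    open PrimitiveIdempotents.Existence A _≈?_ enum index k (λ a → trans (^-congʳ a (≡.sym q≡2+k)) (a^q≈a a))

    u : Carrier
    u = conjugateProduct m

    module At (e : Carrier) (prim : Primitive e) (e≤u : e * idempotent u ≈ e) where

      open Primitive prim
      open Localisation A e

      -- Primitivity gives (a * e)^(k+1) ≈ e when a survives, so (a * e)^k inverts a in the
      -- component.
      inverse : ∀ a → ¬ a ~ 0# → ∃ λ b → a * b ~ 1#
      inverse a a≁0 with minimal a
      ... | inj₁ f≈0 = contradiction (mk (trans (idempotent≈0⇒≈0 (a * e) f≈0) (sym (zeroˡ e)))) a≁0
      ... | inj₂ f≈e = b , mk (begin
        (a * b) * e   ≈⟨ trans (*-assoc a b e) (trans (*-congˡ (*-comm b e)) (sym (*-assoc a e b))) ⟩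
        (a * e) * b   ≈⟨ f≈e ⟩
        e             ≈⟨ *-identityˡ e ⟨
        1# * e        ∎)
        where b = (a * e) ^ k

      -- Coinciding conjugates would make e kill a factor of u, hence u itself. But e lies below the
      -- idempotent power of u, so e would vanish.
      x^≁x : ∀ d → 0 < d → d < suc m → ¬ x ^ (p ℕ.^ d) ~ x
      x^≁x (suc d) _ 1+d<1+m x^~x = e≉0 (begin
        e                     ≈⟨ e≤u ⟨
        e * (u * u ^ k)       ≈⟨ *-assoc e u _ ⟨
        (e * u) * u ^ k       ≈⟨ *-congʳ (trans (*-comm e u) (factor*e≈0⇒product*e≈0 d m e (ℕ.s≤s⁻¹ 1+d<1+m) z≈0)) ⟩
        0# * u ^ k            ≈⟨ zeroˡ _ ⟩
        0#                    ∎)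
        where
        z≈0 : factor d * e ≈ 0#
        z≈0 = begin
          (x ^ (p ℕ.^ suc d) + - x) * e   ≈⟨ at (~-+ x^~x (mk refl)) ⟩
          (x + - x) * e                   ≈⟨ *-congʳ (-‿inverseʳ x) ⟩
          0# * e                          ≈⟨ zeroˡ e ⟩
          0#                              ∎

      residueField : FiniteField (p ℕ.^ suc m)
      residueField = Cardinality.Count.finiteField localisation
        (λ a b → map′ mk at ((a * e) ≈? (b * e)))
        (λ 1~0 → e≉0 (trans (sym (*-identityˡ e)) (trans (at 1~0) (zeroˡ e))))
        inverse pp (≡.subst (_~ 0#) (≡.sym (×-localisation p 1#)) (~-cong p×1≈0)) q≡2+k
        (λ a → ≡.subst (_~ a) (≡.sym (^-localisation a (p ℕ.^ suc m))) (~-cong (a^q≈a a)))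
        x (λ d 0<d d<m x^~x → x^≁x d 0<d d<m (≡.subst (_~ x) (^-localisation x (p ℕ.^ d)) x^~x))

    residueField : FiniteField (p ℕ.^ suc m)
    residueField = from (primitive-below (idempotent u) (idempotent-* u) (λ e≈0 → u≉0 (idempotent≈0⇒≈0 u e≈0)))
      where
      from : (∃ λ e → Primitive e × e * idempotent u ≈ e) → FiniteField (p ℕ.^ suc m)
      from (e , prim , e≤u) = At.residueField e prim e≤u

module GaloisField {p} (pp : Prime p) (m k : ℕ) (q≡2+k : p ℕ.^ suc m ≡ suc (suc k)) where

  instance _ = prime⇒nonZero pp

  1<p : 1 < p
  1<p = ℕ.nonTrivial⇒n>1 p {{prime⇒nonTrivial pp}}

  -- Here N = suc k = q - 1, so the defining relation is X^q = X.
  open CyclicAlgebra p (suc k) using (neg; p×1≈0; X^1+N≈X; Monic; monic-𝟙; monic-⊗; monic-X^-X; monic≉0)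
    renaming (commutativeRing to A; _≈?_ to _≈ᴬ?_)
  open CommutativeRing A
  open Algebra.Properties.CommutativeSemiring.Exp commutativeSemiring

  -- The q-th power respects sums and products, so only the generators need to be checked.
  a^q≈a : ∀ a → a ^ (p ℕ.^ suc m) ≈ a
  a^q≈a 𝟘       = trans (^-congʳ 𝟘 q≡2+k) (zeroˡ (𝟘 ^ suc k))
  a^q≈a 𝟙       = 1^n≈1 (p ℕ.^ suc m)
    where
    1^n≈1 : ∀ n → 𝟙 ^ n ≈ 𝟙
    1^n≈1 zero    = refl
    1^n≈1 (suc n) = trans (*-identityˡ (𝟙 ^ n)) (1^n≈1 n)
  a^q≈a X       = trans (^-congʳ X q≡2+k) X^1+N≈X
  a^q≈a (a ⊕ b) = trans (Frobenius.Characteristic.frobenius^-+ A pp p×1≈0 (suc m) a b) (+-cong (a^q≈a a) (a^q≈a b))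
  a^q≈a (a ⊗ b) = trans (^-distrib-* a b (p ℕ.^ suc m)) (*-cong (a^q≈a a) (a^q≈a b))

  open LinearSpan A X
  open Reduction {p} p×1≈0

  -- Closure under `X` propagates through the expression a; applied to b = 1 it puts every element
  -- into the span.
  span-* : ∀ a {b} → InSpan (suc (suc k)) b → InSpan (suc (suc k)) (a * b)
  span-* 𝟘       {b} sb = span-cong (zeroˡ b) (span-0 (suc (suc k)))
  span-* 𝟙       {b} sb = span-cong (*-identityˡ b) sb
  span-* X       {b} sb = span-x* X^1+N≈X sb
  span-* (a ⊕ c) {b} sb = span-cong (distribʳ b a c) (span-+ (span-* a sb) (span-* c sb))
  span-* (a ⊗ c) {b} sb = span-cong (*-assoc a c b) (span-* a (span-* c sb))

  index : ∀ a → ∃ λ i → a ≈ element (suc (suc k)) i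
  index a = span⇒element (span-cong (sym (*-identityʳ a)) (span-* a (span-1 (suc k))))

  open ConjugateProduct A p X

  degree : ℕ → ℕ
  degree zero    = 0
  degree (suc d) = degree d ℕ.+ p ℕ.^ suc d

  1<p^ : ∀ d → 1 < p ℕ.^ suc d
  1<p^ d = ℕ.≤-trans 1<p (ℕ.m≤m*n p (p ℕ.^ d) {{ℕ.m^n≢0 p d}})

  monic-conjugateProduct : ∀ d → Monic (degree d) (conjugateProduct d)
  monic-conjugateProduct zero    = monic-𝟙
  monic-conjugateProduct (suc d) =
    monic-⊗ {degree d} {p ℕ.^ suc d} {conjugateProduct d} {factor d}
      (monic-conjugateProduct d) (monic-X^-X (p ℕ.^ suc d) (1<p^ d))

  -- The degree is p + ... + p^d. Inductively, adding p^(d+1) to both sides gives at most 2 ·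
  -- p^(d+1), which is at most p^(d+2). The base case 2 ≤ p allows the slack of 2.
  2+degree≤ : ∀ d → 2 ℕ.+ degree d ≤ p ℕ.^ suc d
  2+degree≤ zero    = 1<p^ 0
  2+degree≤ (suc d) = ℕ.≤-trans
    (ℕ.+-mono-≤ (2+degree≤ d) (ℕ.≤-reflexive (≡.sym (ℕ.+-identityʳ (p ℕ.^ suc d)))))
    (ℕ.*-monoˡ-≤ (p ℕ.^ suc d) 1<p)

  conjugateProduct≉0 : ¬ conjugateProduct m ≈ 0#
  conjugateProduct≉0 = monic≉0 1<p {degree m} {conjugateProduct m} (monic-conjugateProduct m)
    (ℕ.m≤n⇒m≤1+n (ℕ.s≤s⁻¹ (ℕ.s≤s⁻¹ (≡.subst (2 ℕ.+ degree m ≤_) q≡2+k (2+degree≤ m)))))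

  galoisField : FiniteField (p ℕ.^ suc m)
  galoisField = ResidueField.Existence.residueField A _≈ᴬ?_ (element (suc (suc k))) index pp p×1≈0 {m} q≡2+k a^q≈a X conjugateProduct≉0

-- Cardinalities as sums of indicators

open Algebra.Properties.CommutativeMonoid.Sum ℕ.+-0-commutativeMonoid
  using (sum; sum-cong-≗; ∑-distrib-+; ∑-comm)
open Algebra.Properties.Semiring.Sum ℕ.+-*-semiring using (*-distribˡ-sum)

ι : Bool → ℕ
ι true  = 1
ι false = 0

ι-∧ : ∀ a b → ι (a ∧ b) ≡ ι a ℕ.* ι b
ι-∧ true  b = ≡.sym (ℕ.+-identityʳ (ι b))
ι-∧ false b = ≡.refl

ι+ι-not : ∀ b → ι b ℕ.+ ι (not b) ≡ 1
ι+ι-not true  = ≡.refl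
ι+ι-not false = ≡.refl

⌊⌋-cong : ∀ {a b} {P : Set a} {Q : Set b} (p? : Dec P) (q? : Dec Q) → (P → Q) → (Q → P) → ⌊ p? ⌋ ≡ ⌊ q? ⌋
⌊⌋-cong (yes p) (yes q) f g = ≡.refl
⌊⌋-cong (yes p) (no ¬q) f g = contradiction (f p) ¬q
⌊⌋-cong (no ¬p) (yes q) f g = contradiction (g q) ¬p
⌊⌋-cong (no ¬p) (no ¬q) f g = ≡.refl

⌊yes⌋ : ∀ {a} {P : Set a} (p? : Dec P) → P → ⌊ p? ⌋ ≡ true
⌊yes⌋ (yes _) p = ≡.refl
⌊yes⌋ (no ¬p) p = contradiction p ¬p

⌊no⌋ : ∀ {a} {P : Set a} (p? : Dec P) → ¬ P → ⌊ p? ⌋ ≡ false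
⌊no⌋ (yes p) ¬p = contradiction p ¬p
⌊no⌋ (no _)  ¬p = ≡.refl

sum-const : ∀ n c → sum {n} (λ _ → c) ≡ n ℕ.* c
sum-const zero    c = ≡.refl
sum-const (suc n) c = cong (c ℕ.+_) (sum-const n c)

sum-↑ : ∀ m {n} (f : Fin (m ℕ.+ n) → ℕ) → sum f ≡ sum (λ i → f (i ↑ˡ n)) ℕ.+ sum (λ j → f (m ↑ʳ j))
sum-↑ zero    f = ≡.refl
sum-↑ (suc m) f = ≡.trans (cong (f Fin.zero ℕ.+_) (sum-↑ m (λ i → f (Fin.suc i)))) (≡.sym (ℕ.+-assoc (f Fin.zero) _ _))

sum-splitAt : ∀ m {n} (F : Fin m ⊎ Fin n → ℕ) →
  sum (λ i → F (splitAt m i)) ≡ sum (λ i → F (inj₁ i)) ℕ.+ sum (λ j → F (inj₂ j))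
sum-splitAt m {n} F = ≡.trans (sum-↑ m (λ i → F (splitAt m i)))
  (cong₂ ℕ._+_ (sum-cong-≗ (λ i → cong F (Fin.splitAt-↑ˡ m i n))) (sum-cong-≗ (λ j → cong F (Fin.splitAt-↑ʳ m n j))))

sum-combine : ∀ m {n} (f : Fin (m ℕ.* n) → ℕ) → sum f ≡ sum {m} (λ i → sum {n} (λ j → f (combine i j)))
sum-combine zero        f = ≡.refl
sum-combine (suc m) {n} f = ≡.trans (sum-↑ n f)
  (cong (sum (λ j → f (j ↑ˡ (m ℕ.* n))) ℕ.+_) (sum-combine m (λ s → f (n ↑ʳ s))))

sum-remQuot : ∀ m {n} (F : Fin m × Fin n → ℕ) →
  sum (λ s → F (remQuot {m} n s)) ≡ sum {m} (λ i → sum {n} (λ j → F (i , j)))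
sum-remQuot m {n} F = ≡.trans (sum-combine m (λ s → F (remQuot {m} n s)))
  (sum-cong-≗ λ i → sum-cong-≗ λ j → cong F (Fin.remQuot-combine i j))

sum-complement : ∀ {n} (f : Fin n → Bool) → sum (λ i → ι (f i)) ℕ.+ sum (λ i → ι (not (f i))) ≡ n
sum-complement {n} f = begin
  sum (λ i → ι (f i)) ℕ.+ sum (λ i → ι (not (f i)))   ≡⟨ ∑-distrib-+ _ (λ i → ι (not (f i))) ⟨
  sum (λ i → ι (f i) ℕ.+ ι (not (f i)))               ≡⟨ sum-cong-≗ (λ i → ι+ι-not (f i)) ⟩
  sum {n} (λ _ → 1)                                   ≡⟨ sum-const n 1 ⟩
  n ℕ.* 1                                             ≡⟨ ℕ.*-identityʳ n ⟩
  n                                                   ∎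
  where open ≡-Reasoning

sum-unique : ∀ {n a} {P : Fin n → Set a} (P? : ∀ i → Dec (P i)) i → P i → (∀ j → P j → j ≡ i) → sum (λ i → ι ⌊ P? i ⌋) ≡ 1
sum-unique {suc n} P? Fin.zero pi uniq = cong₂ ℕ._+_ (cong ι (⌊yes⌋ (P? Fin.zero) pi))
  (≡.trans (sum-cong-≗ λ j → cong ι (⌊no⌋ (P? (Fin.suc j)) λ pj → contradiction (uniq (Fin.suc j) pj) λ ()))
           (≡.trans (sum-const n 0) (ℕ.*-zeroʳ n)))
sum-unique P? (Fin.suc i) pi uniq = cong₂ ℕ._+_
  (cong ι (⌊no⌋ (P? Fin.zero) λ p0 → contradiction (uniq Fin.zero p0) λ ()))
  (sum-unique (λ j → P? (Fin.suc j)) i pi λ j pj → Fin.suc-injective (uniq (Fin.suc j) pj))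

∣tabulate∣ : ∀ {n} (f : Fin n → Bool) → ∣ tabulate f ∣ ≡ sum (λ i → ι (f i))
∣tabulate∣ {zero}  f = ≡.refl
∣tabulate∣ {suc n} f with f Fin.zero
... | true  = cong suc (∣tabulate∣ (λ i → f (Fin.suc i)))
... | false = ∣tabulate∣ (λ i → f (Fin.suc i))

tabulate-∩ : ∀ {n} (f g : Fin n → Bool) → tabulate f ∩ tabulate g ≡ tabulate (λ i → f i ∧ g i)
tabulate-∩ {zero}  f g = ≡.refl
tabulate-∩ {suc n} f g = cong (f Fin.zero ∧ g Fin.zero ∷_) (tabulate-∩ (λ i → f (Fin.suc i)) (λ i → g (Fin.suc i)))

∣tabulate-∩∣ : ∀ {n} (f g : Fin n → Bool) → ∣ tabulate f ∩ tabulate g ∣ ≡ sum (λ i → ι (f i) ℕ.* ι (g i))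
∣tabulate-∩∣ f g = ≡.trans (cong ∣_∣ (tabulate-∩ f g))
  (≡.trans (∣tabulate∣ (λ i → f i ∧ g i)) (sum-cong-≗ λ i → ι-∧ (f i) (g i)))

-- Counting in affine and projective space

module Geometry {q : ℕ} (F : FiniteField q) where

  open FiniteField F renaming (Carrier to K)
  open Algebra.Properties.Group +-group using (inverseˡ-unique; ∙-cancelˡ)

  Zero : ∀ {n} → Vec K n → Set
  Zero = All (_≈ 0#)

  zero? : ∀ {n} (v : Vec K n) → Dec (Zero v)
  zero? = All.all? (_≈? 0#)

  infix 7 _∙_
  _∙_ : ∀ {n} → Vec K n → Vec K n → K
  []      ∙ []      = 0#
  (a ∷ v) ∙ (b ∷ w) = a * b + v ∙ w

  infix 8 _+[_]_
  _+[_]_ : ∀ {n} → Vec K n → K → Vec K n → Vec K n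
  z +[ t ] y = Vec.zipWith (λ a b → a + t * b) z y

  ∙-comm : ∀ {n} (v w : Vec K n) → v ∙ w ≈ w ∙ v
  ∙-comm []      []      = refl
  ∙-comm (a ∷ v) (b ∷ w) = +-cong (*-comm a b) (∙-comm v w)

  ∙-zeroˡ : ∀ {n} {v : Vec K n} → Zero v → ∀ w → v ∙ w ≈ 0#
  ∙-zeroˡ []           []      = refl
  ∙-zeroˡ (a≈0 ∷ v≈0) (b ∷ w) = trans (+-cong (trans (*-congʳ a≈0) (zeroˡ b)) (∙-zeroˡ v≈0 w)) (+-identityˡ 0#)

  module _ where

    open import Relation.Binary.Reasoning.Setoid setoid

    ∙-linear : ∀ {n} (a z : Vec K n) t y → a ∙ (z +[ t ] y) ≈ a ∙ z + t * (a ∙ y)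
    ∙-linear []      []      t []      = sym (trans (+-identityˡ _) (zeroʳ t))
    ∙-linear (a ∷ v) (b ∷ z) t (c ∷ y) = begin
      a * (b + t * c) + v ∙ (z +[ t ] y)
        ≈⟨ +-cong (distribˡ a b (t * c)) (∙-linear v z t y) ⟩
      (a * b + a * (t * c)) + (v ∙ z + t * (v ∙ y))
        ≈⟨ interchange _ _ _ _ ⟩
      (a * b + v ∙ z) + (a * (t * c) + t * (v ∙ y))
        ≈⟨ +-congˡ (+-congʳ (x∙yz≈y∙xz a t c)) ⟩
      (a * b + v ∙ z) + (t * (a * c) + t * (v ∙ y))
        ≈⟨ +-congˡ (distribˡ t _ _) ⟨
      (a * b + v ∙ z) + t * (a * c + v ∙ y) ∎
      where
      open import Algebra.Properties.CommutativeSemigroup +-commutativeSemigroup using (interchange)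
      open import Algebra.Properties.CommutativeSemigroup *-commutativeSemigroup using (x∙yz≈y∙xz)

    sum-*c+d≈0 : ∀ {a} → ¬ a ≈ 0# → ∀ b → sum (λ t → ι ⌊ (b + enum t * a) ≈? 0# ⌋) ≡ 1
    sum-*c+d≈0 {a} a≉0 b with a⁻¹ , aa⁻¹≈1 ← inverse a a≉0 with t , t≈ ← index (- b * a⁻¹) =
      sum-unique (λ t → (b + enum t * a) ≈? 0#) t (solution t≈) λ s eq → enum-injective s t (trans (unique s eq) t≈)
      where
      solution : ∀ {t} → - b * a⁻¹ ≈ t → b + t * a ≈ 0#
      solution {t} t≈ = begin
        b + t * a                ≈⟨ +-congˡ (*-congʳ t≈) ⟨
        b + (- b * a⁻¹) * a      ≈⟨ +-congˡ (trans (*-assoc _ _ _) (*-congˡ (trans (*-comm a⁻¹ a) aa⁻¹≈1))) ⟩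
        b + - b * 1#             ≈⟨ +-congˡ (*-identityʳ _) ⟩
        b + - b                  ≈⟨ -‿inverseʳ b ⟩
        0#                       ∎
      unique : ∀ s → b + enum s * a ≈ 0# → enum s ≈ - b * a⁻¹
      unique s eq = begin
        enum s                   ≈⟨ *-identityʳ _ ⟨
        enum s * 1#              ≈⟨ *-congˡ aa⁻¹≈1 ⟨
        enum s * (a * a⁻¹)       ≈⟨ *-assoc _ _ _ ⟨
        (enum s * a) * a⁻¹       ≈⟨ *-congʳ (inverseˡ-unique _ _ (trans (+-comm _ _) eq)) ⟩
        - b * a⁻¹                ∎

    -- The scalar is -1 only up to `≈`, as supplied by comparing the leading ones of two normalised
    -- vectors.
    a+tb≈0⇒a≈b : ∀ {a b t} → 1# + t ≈ 0# → a + t * b ≈ 0# → a ≈ b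
    a+tb≈0⇒a≈b {a} {b} {t} 1+t≈0 eq = ∙-cancelˡ (t * b) a b (begin
      t * b + a        ≈⟨ trans (+-comm _ _) eq ⟩
      0#               ≈⟨ trans (*-congʳ 1+t≈0) (zeroˡ b) ⟨
      (1# + t) * b     ≈⟨ trans (distribʳ b 1# t) (+-congʳ (*-identityˡ b)) ⟩
      b + t * b        ≈⟨ +-comm _ _ ⟩
      t * b + b        ∎)

  open ≡-Reasoning

  sum-≈enum : ∀ a → sum (λ b → ι ⌊ a ≈? enum b ⌋) ≡ 1
  sum-≈enum a with i , a≈i ← index a =
    sum-unique (λ b → a ≈? enum b) i a≈i λ j a≈j → enum-injective j i (trans (sym a≈j) a≈i)

  point : ∀ n → Fin (q ℕ.^ n) → Vec K n
  point n i = Vec.map enum (toVec n i)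

  sum-point : ∀ n (f : Vec K (suc n) → ℕ) →
    sum (λ i → f (point (suc n) i)) ≡ sum (λ c → sum (λ i → f (enum c ∷ point n i)))
  sum-point n f = sum-remQuot q (λ s → f (enum (proj₁ s) ∷ point n (proj₂ s)))

  -- This is (q^n - 1)/(q - 1) as a geometric sum: among the normalised vectors of length n + 1, q^n
  -- begin with 1 and the others with 0.
  size : ℕ → ℕ
  size zero    = 0
  size (suc n) = q ℕ.^ n ℕ.+ size n

  -- Representatives of the points of projective space: the first nonzero coordinate is 1.
  direction : ∀ n → Fin (size n) → Vec K n
  direction⊎ : ∀ n → Fin (q ℕ.^ n) ⊎ Fin (size n) → Vec K (suc n)
  direction (suc n) i = direction⊎ n (splitAt (q ℕ.^ n) i)
  direction⊎ n (inj₁ i) = 1# ∷ point n i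
  direction⊎ n (inj₂ j) = 0# ∷ direction n j

  direction≉0 : ∀ n i → ¬ Zero (direction n i)
  direction≉0 (suc n) i z with splitAt (q ℕ.^ n) i
  direction≉0 (suc n) i (1≈0 ∷ _) | inj₁ _ = 1≉0 1≈0
  direction≉0 (suc n) i (_ ∷ z)   | inj₂ j = direction≉0 n j z

  point-injective : ∀ n i j {t} → 1# + t ≈ 0# → Zero (point n i +[ t ] point n j) → i ≡ j
  point-injective n i j {t} 1+t≈0 z = toVec-injective n (go (toVec n i) (toVec n j) z)
    where
    go : ∀ {n} (is js : Vec (Fin q) n) → Zero (Vec.map enum is +[ t ] Vec.map enum js) → is ≡ js
    go []       []       []      = ≡.refl
    go (i ∷ is) (j ∷ js) (z ∷ zs) = cong₂ _∷_ (enum-injective i j (a+tb≈0⇒a≈b 1+t≈0 z)) (go is js zs)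

  -- Leading coordinates decide: two ones force t = -1, a one against a zero gives 1 = 0, and a zero
  -- against a one forces t = 0, so that the first direction would vanish.
  direction-independent : ∀ n i j t → Zero (direction n i +[ t ] direction n j) → i ≡ j
  direction-independent (suc n) i j t z = splitAt-injective (go (splitAt (q ℕ.^ n) i) (splitAt (q ℕ.^ n) j) z)
    where
    splitAt-injective : splitAt (q ℕ.^ n) i ≡ splitAt (q ℕ.^ n) j → i ≡ j
    splitAt-injective eq = ≡.trans (≡.sym (Fin.join-splitAt (q ℕ.^ n) (size n) i))
      (≡.trans (cong (join (q ℕ.^ n) (size n)) eq) (Fin.join-splitAt (q ℕ.^ n) (size n) j))
    vanish : ∀ {m} (v w : Vec K m) → t ≈ 0# → Zero (v +[ t ] w) → Zero v
    vanish []      []      t≈0 []       = []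
    vanish (a ∷ v) (b ∷ w) t≈0 (z ∷ zs) =
      trans (sym (trans (+-congˡ (trans (*-congʳ t≈0) (zeroˡ b))) (+-identityʳ a))) z ∷ vanish v w t≈0 zs
    go : ∀ i j → Zero (direction⊎ n i +[ t ] direction⊎ n j) → i ≡ j
    go (inj₁ i) (inj₁ j) (z ∷ zs) = cong inj₁ (point-injective n i j (trans (+-congˡ (sym (*-identityʳ t))) z) zs)
    go (inj₁ i) (inj₂ j) (z ∷ zs) = contradiction (trans (sym (trans (+-congˡ (zeroʳ t)) (+-identityʳ 1#))) z) 1≉0
    go (inj₂ i) (inj₁ j) (z ∷ zs) = contradiction
      (vanish _ (point n j) (trans (sym (trans (+-identityˡ _) (*-identityʳ t))) z) zs) (direction≉0 n i)
    go (inj₂ i) (inj₂ j) (z ∷ zs) = cong inj₂ (direction-independent n i j t zs)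

  sum-direction : ∀ n (f : Vec K (suc n) → ℕ) →
    sum (λ i → f (direction (suc n) i)) ≡ sum (λ i → f (1# ∷ point n i)) ℕ.+ sum (λ j → f (0# ∷ direction n j))
  sum-direction n f = sum-splitAt (q ℕ.^ n) (λ s → f (direction⊎ n s))

  ⌊≈0⌋-cong : ∀ {a b} → a ≈ b → ⌊ a ≈? 0# ⌋ ≡ ⌊ b ≈? 0# ⌋
  ⌊≈0⌋-cong {a} {b} a≈b = ⌊⌋-cong (a ≈? 0#) (b ≈? 0#) (trans (sym a≈b)) (trans a≈b)

  -- If the tail v is zero, the first coordinate is determined and the others are free. If not, each
  -- value of the first coordinate is absorbed into the constant b, which is general for this
  -- purpose.
  hyperplane : ∀ n (a : Vec K (suc n)) → ¬ Zero a → ∀ b →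
    sum (λ i → ι ⌊ (b + a ∙ point (suc n) i) ≈? 0# ⌋) ≡ q ℕ.^ n
  hyperplane n (a ∷ v) a≉0 b with zero? v
  hyperplane n (a ∷ v) a≉0 b | yes v≈0 = begin
    sum (λ i → ι ⌊ (b + (a ∷ v) ∙ point (suc n) i) ≈? 0# ⌋)
      ≡⟨ sum-point n (λ x → ι ⌊ (b + (a ∷ v) ∙ x) ≈? 0# ⌋) ⟩
    sum (λ c → sum (λ i → ι ⌊ (b + (a * enum c + v ∙ point n i)) ≈? 0# ⌋))
      ≡⟨ sum-cong-≗ (λ c → sum-cong-≗ λ i → cong ι (⌊≈0⌋-cong (+-congˡ (trans (+-cong (*-comm a (enum c)) (∙-zeroˡ v≈0 (point n i))) (+-identityʳ _))))) ⟩
    sum (λ c → sum {q ℕ.^ n} (λ i → ι ⌊ (b + enum c * a) ≈? 0# ⌋))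
      ≡⟨ sum-cong-≗ (λ c → sum-const (q ℕ.^ n) (ι ⌊ (b + enum c * a) ≈? 0# ⌋)) ⟩
    sum (λ c → q ℕ.^ n ℕ.* ι ⌊ (b + enum c * a) ≈? 0# ⌋)
      ≡⟨ *-distribˡ-sum (q ℕ.^ n) (λ c → ι ⌊ (b + enum c * a) ≈? 0# ⌋) ⟨
    q ℕ.^ n ℕ.* sum (λ c → ι ⌊ (b + enum c * a) ≈? 0# ⌋)
      ≡⟨ cong (q ℕ.^ n ℕ.*_) (sum-*c+d≈0 (λ a≈0 → a≉0 (a≈0 ∷ v≈0)) b) ⟩
    q ℕ.^ n ℕ.* 1
      ≡⟨ ℕ.*-identityʳ (q ℕ.^ n) ⟩
    q ℕ.^ n ∎
  hyperplane zero    (a ∷ []) a≉0 b | no v≉0 = contradiction [] v≉0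
  hyperplane (suc n) (a ∷ v)  a≉0 b | no v≉0 = begin
    sum (λ i → ι ⌊ (b + (a ∷ v) ∙ point (suc (suc n)) i) ≈? 0# ⌋)
      ≡⟨ sum-point (suc n) (λ x → ι ⌊ (b + (a ∷ v) ∙ x) ≈? 0# ⌋) ⟩
    sum (λ c → sum (λ i → ι ⌊ (b + (a * enum c + v ∙ point (suc n) i)) ≈? 0# ⌋))
      ≡⟨ sum-cong-≗ (λ c → sum-cong-≗ λ i → cong ι (⌊≈0⌋-cong (sym (+-assoc b (a * enum c) (v ∙ point (suc n) i))))) ⟩
    sum (λ c → sum (λ i → ι ⌊ ((b + a * enum c) + v ∙ point (suc n) i) ≈? 0# ⌋))
      ≡⟨ sum-cong-≗ (λ c → hyperplane n v v≉0 (b + a * enum c)) ⟩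
    sum {q} (λ c → q ℕ.^ n)
      ≡⟨ sum-const q (q ℕ.^ n) ⟩
    q ℕ.^ suc n ∎

  nonorthogonal : ∀ {n} → Vec K n → Vec K n → ℕ
  nonorthogonal v w = ι (not ⌊ v ∙ w ≈? 0# ⌋)

  nonorthogonal-cong : ∀ {a b} → a ≈ b → ι (not ⌊ a ≈? 0# ⌋) ≡ ι (not ⌊ b ≈? 0# ⌋)
  nonorthogonal-cong a≈b = cong (λ c → ι (not c)) (⌊≈0⌋-cong a≈b)

  -- For v = 0 exactly the q^n directions beginning with 1 count. Otherwise the directions beginning
  -- with 0 contribute, by induction, as many as there are points x with a + v ∙ x = 0, the ones
  -- missing from the first block.
  sum-nonorthogonal : ∀ n (z : Vec K (suc n)) → ¬ Zero z →
    sum (λ j → nonorthogonal (direction (suc n) j) z) ≡ q ℕ.^ n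
  sum-nonorthogonal n (a ∷ v) z≉0 = ≡.trans (sum-direction n (λ d → nonorthogonal d (a ∷ v)))
    (≡.trans (cong₂ ℕ._+_
      (sum-cong-≗ λ i → nonorthogonal-cong (+-cong (*-identityˡ a) (∙-comm (point n i) v)))
      (sum-cong-≗ λ j → nonorthogonal-cong (trans (+-congʳ (zeroˡ a)) (+-identityˡ (direction n j ∙ v)))))
      (go n v (zero? v) z≉0))
    where
    go : ∀ n (v : Vec K n) → Dec (Zero v) → ¬ Zero (a ∷ v) →
      sum (λ i → ι (not ⌊ (a + v ∙ point n i) ≈? 0# ⌋)) ℕ.+ sum (λ j → nonorthogonal (direction n j) v) ≡ q ℕ.^ n
    go n v (yes v≈0) z≉0 = begin
      sum (λ i → ι (not ⌊ (a + v ∙ point n i) ≈? 0# ⌋)) ℕ.+ sum (λ j → nonorthogonal (direction n j) v)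
        ≡⟨ cong₂ ℕ._+_
          (sum-cong-≗ λ i → cong (λ c → ι (not c)) (⌊no⌋ ((a + v ∙ point n i) ≈? 0#)
            λ eq → z≉0 (trans (sym (trans (+-congˡ (∙-zeroˡ v≈0 (point n i))) (+-identityʳ a))) eq ∷ v≈0)))
          (sum-cong-≗ λ j → cong (λ c → ι (not c)) (⌊yes⌋ (direction n j ∙ v ≈? 0#)
            (trans (∙-comm (direction n j) v) (∙-zeroˡ v≈0 (direction n j))))) ⟩
      sum {q ℕ.^ n} (λ _ → 1) ℕ.+ sum {size n} (λ _ → 0)
        ≡⟨ cong₂ ℕ._+_ (≡.trans (sum-const (q ℕ.^ n) 1) (ℕ.*-identityʳ (q ℕ.^ n))) (≡.trans (sum-const (size n) 0) (ℕ.*-zeroʳ (size n))) ⟩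
      q ℕ.^ n ℕ.+ 0
        ≡⟨ ℕ.+-identityʳ _ ⟩
      q ℕ.^ n ∎
    go zero    []      (no v≉0) z≉0 = contradiction [] v≉0
    go (suc n) v       (no v≉0) z≉0 = begin
      S ℕ.+ sum (λ j → nonorthogonal (direction (suc n) j) v)
        ≡⟨ cong (S ℕ.+_) (≡.trans (sum-nonorthogonal n v v≉0) (≡.sym (hyperplane n v v≉0 a))) ⟩
      S ℕ.+ sum (λ i → ι ⌊ (a + v ∙ point (suc n) i) ≈? 0# ⌋)
        ≡⟨ ℕ.+-comm S _ ⟩
      sum (λ i → ι ⌊ (a + v ∙ point (suc n) i) ≈? 0# ⌋) ℕ.+ S
        ≡⟨ sum-complement (λ i → ⌊ (a + v ∙ point (suc n) i) ≈? 0# ⌋) ⟩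
      q ℕ.^ suc n ∎
      where
      S = sum (λ i → ι (not ⌊ (a + v ∙ point (suc n) i) ≈? 0# ⌋))

  -- With a = d ∙ y and b = d ∙ z: summing over the pencil z + t y reduces the joint count A * B to single counts.
  nonorthogonal-pencil : ∀ a b → let A = ι (not ⌊ a ≈? 0# ⌋) ; B = ι (not ⌊ b ≈? 0# ⌋) in
    sum (λ t → ι (not ⌊ b + enum t * a ≈? 0# ⌋)) ℕ.+ A ℕ.+ q ℕ.* (A ℕ.* B) ≡ q ℕ.* A ℕ.+ q ℕ.* B
  nonorthogonal-pencil a b with a ≈? 0#
  ... | yes a≈0 = begin
    sum (λ t → ι (not ⌊ b + enum t * a ≈? 0# ⌋)) ℕ.+ 0 ℕ.+ q ℕ.* 0
      ≡⟨ cong (ℕ._+ q ℕ.* 0) (ℕ.+-identityʳ (sum (λ t → ι (not ⌊ b + enum t * a ≈? 0# ⌋)))) ⟩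
    sum (λ t → ι (not ⌊ b + enum t * a ≈? 0# ⌋)) ℕ.+ q ℕ.* 0
      ≡⟨ cong (ℕ._+ q ℕ.* 0) (sum-cong-≗ λ t → nonorthogonal-cong
          (trans (+-congˡ (trans (*-congˡ a≈0) (zeroʳ (enum t)))) (+-identityʳ b))) ⟩
    sum {q} (λ t → ι (not ⌊ b ≈? 0# ⌋)) ℕ.+ q ℕ.* 0
      ≡⟨ cong (ℕ._+ q ℕ.* 0) (sum-const q (ι (not ⌊ b ≈? 0# ⌋))) ⟩
    q ℕ.* ι (not ⌊ b ≈? 0# ⌋) ℕ.+ q ℕ.* 0
      ≡⟨ ℕ.+-comm _ (q ℕ.* 0) ⟩
    q ℕ.* 0 ℕ.+ q ℕ.* ι (not ⌊ b ≈? 0# ⌋) ∎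
  ... | no  a≉0 = cong₂ ℕ._+_
    (begin
      S ℕ.+ 1                                               ≡⟨ ℕ.+-comm S 1 ⟩
      1 ℕ.+ S                                               ≡⟨ cong (ℕ._+ S) (sum-*c+d≈0 a≉0 b) ⟨
      sum (λ t → ι ⌊ b + enum t * a ≈? 0# ⌋) ℕ.+ S          ≡⟨ sum-complement (λ t → ⌊ b + enum t * a ≈? 0# ⌋) ⟩
      q                                                     ≡⟨ ℕ.*-identityʳ q ⟨
      q ℕ.* 1                                               ∎)
    (cong (q ℕ.*_) (ℕ.+-identityʳ (ι (not ⌊ b ≈? 0# ⌋))))
    where
    S = sum (λ t → ι (not ⌊ b + enum t * a ≈? 0# ⌋))

  -- The pencil identity is summed over all directions. Each z + t y is nonzero, so every single
  -- count is q^n, and one term q · q^n cancels from both sides.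
  sum-nonorthogonal₂ : ∀ n (y z : Vec K (suc n)) → ¬ Zero y → ¬ Zero z → (∀ t → ¬ Zero (z +[ t ] y)) →
    q ℕ.^ n ℕ.+ q ℕ.* sum (λ j → nonorthogonal (direction (suc n) j) y ℕ.* nonorthogonal (direction (suc n) j) z) ≡ q ℕ.* q ℕ.^ n
  sum-nonorthogonal₂ n y z y≉0 z≉0 independent = ℕ.+-cancelˡ-≡ (q ℕ.* q ℕ.^ n) _ _ (begin
    q ℕ.* q ℕ.^ n ℕ.+ (q ℕ.^ n ℕ.+ q ℕ.* sum AB)
      ≡⟨ ℕ.+-assoc (q ℕ.* q ℕ.^ n) _ _ ⟨
    q ℕ.* q ℕ.^ n ℕ.+ q ℕ.^ n ℕ.+ q ℕ.* sum AB
      ≡⟨ cong₂ ℕ._+_ (cong₂ ℕ._+_ ∑L≡ (sum-nonorthogonal n y y≉0)) (≡.sym (*-distribˡ-sum q AB)) ⟨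
    sum L ℕ.+ sum A ℕ.+ sum (λ j → q ℕ.* AB j)
      ≡⟨ cong (ℕ._+ sum (λ j → q ℕ.* AB j)) (∑-distrib-+ L A) ⟨
    sum (λ j → L j ℕ.+ A j) ℕ.+ sum (λ j → q ℕ.* AB j)
      ≡⟨ ∑-distrib-+ (λ j → L j ℕ.+ A j) (λ j → q ℕ.* AB j) ⟨
    sum (λ j → L j ℕ.+ A j ℕ.+ q ℕ.* AB j)
      ≡⟨ sum-cong-≗ (λ j → nonorthogonal-pencil (d j ∙ y) (d j ∙ z)) ⟩
    sum (λ j → q ℕ.* A j ℕ.+ q ℕ.* B j)
      ≡⟨ ∑-distrib-+ (λ j → q ℕ.* A j) (λ j → q ℕ.* B j) ⟩
    sum (λ j → q ℕ.* A j) ℕ.+ sum (λ j → q ℕ.* B j)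
      ≡⟨ cong₂ ℕ._+_ (*-distribˡ-sum q A) (*-distribˡ-sum q B) ⟨
    q ℕ.* sum A ℕ.+ q ℕ.* sum B
      ≡⟨ cong₂ (λ a b → q ℕ.* a ℕ.+ q ℕ.* b) (sum-nonorthogonal n y y≉0) (sum-nonorthogonal n z z≉0) ⟩
    q ℕ.* q ℕ.^ n ℕ.+ q ℕ.* q ℕ.^ n ∎)
    where
    d : Fin (size (suc n)) → Vec K (suc n)
    d = direction (suc n)
    A B AB L : Fin (size (suc n)) → ℕ
    A j  = nonorthogonal (d j) y
    B j  = nonorthogonal (d j) z
    AB j = A j ℕ.* B j
    L j  = sum (λ t → ι (not ⌊ d j ∙ z + enum t * (d j ∙ y) ≈? 0# ⌋))
    ∑L≡ : sum L ≡ q ℕ.* q ℕ.^ n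
    ∑L≡ = begin
      sum L
        ≡⟨ ∑-comm (λ j t → ι (not ⌊ d j ∙ z + enum t * (d j ∙ y) ≈? 0# ⌋)) ⟩
      sum (λ t → sum (λ j → ι (not ⌊ d j ∙ z + enum t * (d j ∙ y) ≈? 0# ⌋)))
        ≡⟨ sum-cong-≗ (λ t → sum-cong-≗ λ j → nonorthogonal-cong (∙-linear (d j) z (enum t) y)) ⟨
      sum (λ t → sum (λ j → nonorthogonal (d j) (z +[ enum t ] y)))
        ≡⟨ sum-cong-≗ (λ t → sum-nonorthogonal n (z +[ enum t ] y) (independent (enum t))) ⟩
      sum {q} (λ t → q ℕ.^ n)
        ≡⟨ sum-const q (q ℕ.^ n) ⟩
      q ℕ.* q ℕ.^ n ∎

  size-suc : ∀ n → size (suc n) ≡ suc (q ℕ.* size n)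
  size-suc zero    = cong suc (≡.sym (ℕ.*-zeroʳ q))
  size-suc (suc n) = begin
    q ℕ.* q ℕ.^ n ℕ.+ size (suc n)         ≡⟨ cong (q ℕ.* q ℕ.^ n ℕ.+_) (size-suc n) ⟩
    q ℕ.* q ℕ.^ n ℕ.+ suc (q ℕ.* size n)   ≡⟨ ℕ.+-suc _ _ ⟩
    suc (q ℕ.* q ℕ.^ n ℕ.+ q ℕ.* size n)   ≡⟨ cong suc (ℕ.*-distribˡ-+ q (q ℕ.^ n) (size n)) ⟨
    suc (q ℕ.* size (suc n))               ∎

  1+size*[q-1]≡q^n : 0 < q → ∀ n → suc (size n ℕ.* (q ∸ 1)) ≡ q ℕ.^ n
  1+size*[q-1]≡q^n 0<q zero    = ≡.refl
  1+size*[q-1]≡q^n 0<q (suc n) = begin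
    suc ((q ℕ.^ n ℕ.+ size n) ℕ.* (q ∸ 1))               ≡⟨ cong suc (ℕ.*-distribʳ-+ (q ∸ 1) (q ℕ.^ n) (size n)) ⟩
    suc (q ℕ.^ n ℕ.* (q ∸ 1) ℕ.+ size n ℕ.* (q ∸ 1))     ≡⟨ ℕ.+-suc _ _ ⟨
    q ℕ.^ n ℕ.* (q ∸ 1) ℕ.+ suc (size n ℕ.* (q ∸ 1))     ≡⟨ cong (q ℕ.^ n ℕ.* (q ∸ 1) ℕ.+_) (1+size*[q-1]≡q^n 0<q n) ⟩
    q ℕ.^ n ℕ.* (q ∸ 1) ℕ.+ q ℕ.^ n                      ≡⟨ ℕ.+-comm _ (q ℕ.^ n) ⟩
    q ℕ.^ n ℕ.+ q ℕ.^ n ℕ.* (q ∸ 1)                      ≡⟨ ℕ.*-suc (q ℕ.^ n) (q ∸ 1) ⟨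
    q ℕ.^ n ℕ.* suc (q ∸ 1)                              ≡⟨ cong (q ℕ.^ n ℕ.*_) (ℕ.m+[n∸m]≡n 0<q) ⟩
    q ℕ.^ n ℕ.* q                                        ≡⟨ ℕ.*-comm (q ℕ.^ n) q ⟩
    q ℕ.^ suc n                                          ∎

  -- The triple array and its resolvability

  module TripleArray (2≤q : 2 ≤ q) (m : ℕ) where

    n r : ℕ
    n = suc (suc m)
    r = size n

    instance
      q≢0 : NonZero q
      q≢0 = ℕ.>-nonZero (ℕ.<-trans (s≤s z≤n) 2≤q)

    dir : Fin r → Vec K n
    dir = direction n

    pt : Fin (q ℕ.^ n) → Vec K n
    pt = point n

    -- A symbol encodes a pair (b, a), standing for the affine hyperplane a ∙ x = b; b is its value
    -- and a its parallel class.
    value : Fin (q ℕ.* r) → Fin q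
    value s = proj₁ (remQuot {q} r s)

    class : Fin (q ℕ.* r) → Fin r
    class s = proj₂ (remQuot {q} r s)

    incident : Fin (q ℕ.^ n) → Fin q → Fin r → Bool
    incident x b a = ⌊ dir a ∙ pt x ≈? enum b ⌋

    inRow : Fin r → Fin r → Bool
    inRow i a = not ⌊ dir a ∙ dir i ≈? 0# ⌋

    column : Fin (q ℕ.^ n) → Subset (q ℕ.* r)
    column x = tabulate λ s → incident x (value s) (class s)

    row : Fin r → Subset (q ℕ.* r)
    row i = tabulate λ s → inRow i (class s)

    sum-symbols : (f : Fin q → Fin r → ℕ) → sum (λ s → f (value s) (class s)) ≡ sum (λ a → sum (λ b → f b a))
    sum-symbols f = ≡.trans (sum-remQuot q (λ s → f (proj₁ s) (proj₂ s))) (∑-comm f)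

    sum-row : ∀ i → sum (λ a → ι (inRow i a)) ≡ q ℕ.^ suc m
    sum-row i = sum-nonorthogonal (suc m) (dir i) (direction≉0 n i)

    sum-rows : (f : Fin r → ℕ) → sum (λ s → f (class s)) ≡ q ℕ.* sum f
    sum-rows f = begin
      sum (λ s → f (class s))             ≡⟨ sum-symbols (λ _ → f) ⟩
      sum (λ a → sum {q} (λ b → f a))     ≡⟨ sum-cong-≗ (λ a → sum-const q (f a)) ⟩
      sum (λ a → q ℕ.* f a)               ≡⟨ *-distribˡ-sum q f ⟨
      q ℕ.* sum f                         ∎

    -- Each class has exactly one hyperplane through x, so weights depending on the class sum over a
    -- column as over all classes. Column sizes, row-column intersections and transversality are
    -- instances.
    sum-column : ∀ x (f : Fin r → ℕ) → sum (λ s → ι (incident x (value s) (class s)) ℕ.* f (class s)) ≡ sum f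
    sum-column x f = begin
      sum (λ s → ι (incident x (value s) (class s)) ℕ.* f (class s))
        ≡⟨ sum-symbols (λ b a → ι (incident x b a) ℕ.* f a) ⟩
      sum (λ a → sum (λ b → ι (incident x b a) ℕ.* f a))
        ≡⟨ sum-cong-≗ (λ a → sum-cong-≗ λ b → ℕ.*-comm (ι (incident x b a)) (f a)) ⟩
      sum (λ a → sum (λ b → f a ℕ.* ι (incident x b a)))
        ≡⟨ sum-cong-≗ (λ a → *-distribˡ-sum (f a) (λ b → ι (incident x b a))) ⟨
      sum (λ a → f a ℕ.* sum (λ b → ι (incident x b a)))
        ≡⟨ sum-cong-≗ (λ a → ≡.trans (cong (f a ℕ.*_) (sum-≈enum (dir a ∙ pt x))) (ℕ.*-identityʳ (f a))) ⟩
      sum f ∎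

    row-size : ∀ i → ∣ row i ∣ ≡ q ℕ.^ n
    row-size i = begin
      ∣ row i ∣                               ≡⟨ ∣tabulate∣ (λ s → inRow i (class s)) ⟩
      sum (λ s → ι (inRow i (class s)))       ≡⟨ sum-rows (λ a → ι (inRow i a)) ⟩
      q ℕ.* sum (λ a → ι (inRow i a))         ≡⟨ cong (q ℕ.*_) (sum-row i) ⟩
      q ℕ.^ n                                 ∎

    column-size : ∀ x → ∣ column x ∣ ≡ r
    column-size x = begin
      ∣ column x ∣
        ≡⟨ ∣tabulate∣ (λ s → incident x (value s) (class s)) ⟩
      sum (λ s → ι (incident x (value s) (class s)))
        ≡⟨ sum-cong-≗ (λ s → ℕ.*-identityʳ (ι (incident x (value s) (class s)))) ⟨
      sum (λ s → ι (incident x (value s) (class s)) ℕ.* 1)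
        ≡⟨ sum-column x (λ _ → 1) ⟩
      sum {r} (λ _ → 1)
        ≡⟨ ≡.trans (sum-const r 1) (ℕ.*-identityʳ r) ⟩
      r ∎

    containing-tabulate : ∀ {l v} (f : Fin l → Fin v → Bool) s →
      ∣ containing (λ i → tabulate (f i)) s ∣ ≡ sum (λ i → ι (f i s))
    containing-tabulate f s = ≡.trans (∣tabulate∣ (λ i → lookup (tabulate (f i)) s))
      (sum-cong-≗ λ i → cong ι (lookup∘tabulate (f i) s))

    row-rep : ∀ s → ∣ containing row s ∣ ≡ q ℕ.^ suc m
    row-rep s = begin
      ∣ containing row s ∣                         ≡⟨ containing-tabulate (λ i s → inRow i (class s)) s ⟩
      sum (λ i → ι (inRow i (class s)))            ≡⟨ sum-cong-≗ (λ i → nonorthogonal-cong (∙-comm (dir (class s)) (dir i))) ⟩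
      sum (λ i → ι (inRow (class s) i))            ≡⟨ sum-row (class s) ⟩
      q ℕ.^ suc m                                  ∎

    column-rep : ∀ s → ∣ containing column s ∣ ≡ q ℕ.^ suc m
    column-rep s = begin
      ∣ containing column s ∣
        ≡⟨ containing-tabulate (λ x s → incident x (value s) (class s)) s ⟩
      sum (λ x → ι ⌊ dir a ∙ pt x ≈? b ⌋)
        -- Moving b to the left gives the affine equation counted by `hyperplane`.
        ≡⟨ sum-cong-≗ (λ x → cong ι (⌊⌋-cong (dir a ∙ pt x ≈? b) (- b + dir a ∙ pt x ≈? 0#)
             (λ eq → trans (+-congˡ eq) (-‿inverseˡ b))
             (λ eq → ∙-cancelˡ (- b) (dir a ∙ pt x) b (trans eq (sym (-‿inverseˡ b)))))) ⟩
      sum (λ x → ι ⌊ - b + dir a ∙ pt x ≈? 0# ⌋)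
        ≡⟨ hyperplane (suc m) (dir a) (direction≉0 n a) (- b) ⟩
      q ℕ.^ suc m ∎
      where
      a = class s
      b = enum (value s)

    row-column : ∀ i x → ∣ row i ∩ column x ∣ ≡ q ℕ.^ suc m
    row-column i x = begin
      ∣ row i ∩ column x ∣
        ≡⟨ ∣tabulate-∩∣ (λ s → inRow i (class s)) (λ s → incident x (value s) (class s)) ⟩
      sum (λ s → ι (inRow i (class s)) ℕ.* ι (incident x (value s) (class s)))
        ≡⟨ sum-cong-≗ (λ s → ℕ.*-comm (ι (inRow i (class s))) _) ⟩
      sum (λ s → ι (incident x (value s) (class s)) ℕ.* ι (inRow i (class s)))
        ≡⟨ sum-column x (λ a → ι (inRow i a)) ⟩
      sum (λ a → ι (inRow i a))
        ≡⟨ sum-row i ⟩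
      q ℕ.^ suc m ∎

    -- Each class orthogonal to neither i nor j contributes q symbols. In dimension m + 2 the
    -- equation for the number of these classes has a common factor q, which cancels.
    row-row : ∀ i j → i ≢ j → ∣ row i ∩ row j ∣ ≡ q ℕ.* (q ℕ.^ suc m ∸ q ℕ.^ m)
    row-row i j i≢j = begin
      ∣ row i ∩ row j ∣
        ≡⟨ ∣tabulate-∩∣ (λ s → inRow i (class s)) (λ s → inRow j (class s)) ⟩
      sum (λ s → ι (inRow i (class s)) ℕ.* ι (inRow j (class s)))
        ≡⟨ sum-rows (λ a → ι (inRow i a) ℕ.* ι (inRow j a)) ⟩
      q ℕ.* S
        ≡⟨ cong (q ℕ.*_) (ℕ.m+n∸m≡n (q ℕ.^ m) S) ⟨
      q ℕ.* (q ℕ.^ m ℕ.+ S ∸ q ℕ.^ m)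
        ≡⟨ cong (λ k → q ℕ.* (k ∸ q ℕ.^ m)) (ℕ.*-cancelˡ-≡ _ _ q (≡.trans (ℕ.*-distribˡ-+ q (q ℕ.^ m) S)
             (sum-nonorthogonal₂ (suc m) (dir i) (dir j) (direction≉0 n i) (direction≉0 n j)
               (λ t z → i≢j (≡.sym (direction-independent n j i t z)))))) ⟩
      q ℕ.* (q ℕ.^ suc m ∸ q ℕ.^ m) ∎
      where S = sum (λ a → ι (inRow i a) ℕ.* ι (inRow j a))

    -- Two points lie on a common hyperplane of class a exactly when a is orthogonal to w = x - y.
    -- As w is nonzero, all but q^(m+1) of the r classes qualify.
    column-column : ∀ x y → x ≢ y → ∣ column x ∩ column y ∣ ≡ size (suc m)
    column-column x y x≢y = begin
      ∣ column x ∩ column y ∣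
        ≡⟨ ∣tabulate-∩∣ (λ s → incident x (value s) (class s)) (λ s → incident y (value s) (class s)) ⟩
      sum (λ s → ι (incident x (value s) (class s)) ℕ.* ι (incident y (value s) (class s)))
        ≡⟨ sum-symbols (λ b a → ι (incident x b a) ℕ.* ι (incident y b a)) ⟩
      sum (λ a → sum (λ b → ι (incident x b a) ℕ.* ι (incident y b a)))
        ≡⟨ sum-cong-≗ (λ a → common (dir a ∙ pt x) (dir a ∙ pt y)) ⟩
      sum (λ a → ι ⌊ dir a ∙ pt x ≈? dir a ∙ pt y ⌋)
        ≡⟨ sum-cong-≗ (λ a → cong ι (⌊⌋-cong (dir a ∙ pt x ≈? dir a ∙ pt y) (dir a ∙ w ≈? 0#)
             (λ eq → trans (∙-linear (dir a) (pt x) (- 1#) (pt y)) (trans (+-cong eq (-1*x≈-x _)) (-‿inverseʳ _)))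
             (λ eq → a+tb≈0⇒a≈b (-‿inverseʳ 1#) (trans (sym (∙-linear (dir a) (pt x) (- 1#) (pt y))) eq)))) ⟩
      S
        ≡⟨ ℕ.m+n∸n≡m S (q ℕ.^ suc m) ⟨
      S ℕ.+ q ℕ.^ suc m ∸ q ℕ.^ suc m
        ≡⟨ cong (λ k → S ℕ.+ k ∸ q ℕ.^ suc m) (sum-nonorthogonal (suc m) w λ z → x≢y (point-injective n x y (-‿inverseʳ 1#) z)) ⟨
      S ℕ.+ sum (λ a → nonorthogonal (dir a) w) ∸ q ℕ.^ suc m
        ≡⟨ cong (_∸ q ℕ.^ suc m) (sum-complement (λ a → ⌊ dir a ∙ w ≈? 0# ⌋)) ⟩
      r ∸ q ℕ.^ suc m
        ≡⟨ ℕ.m+n∸m≡n (q ℕ.^ suc m) (size (suc m)) ⟩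
      size (suc m) ∎
      where
      open Algebra.Properties.Ring ring using (-1*x≈-x)
      w = pt x +[ - 1# ] pt y
      S = sum (λ a → ι ⌊ dir a ∙ w ≈? 0# ⌋)
      common : ∀ u v → sum (λ b → ι ⌊ u ≈? enum b ⌋ ℕ.* ι ⌊ v ≈? enum b ⌋) ≡ ι ⌊ u ≈? v ⌋
      common u v with u ≈? v
      ... | yes u≈v = ≡.trans (sum-cong-≗ λ b → ≡.trans
                (cong (λ c → ι c ℕ.* ι ⌊ v ≈? enum b ⌋) (⌊⌋-cong (u ≈? enum b) (v ≈? enum b) (trans (sym u≈v)) (trans u≈v)))
                (ι*ι ⌊ v ≈? enum b ⌋)) (sum-≈enum v)
        where
        ι*ι : ∀ c → ι c ℕ.* ι c ≡ ι c
        ι*ι true  = ≡.refl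
        ι*ι false = ≡.refl
      ... | no  u≉v = ≡.trans (sum-cong-≗ disjoint) (≡.trans (sum-const q 0) (ℕ.*-zeroʳ q))
        where
        disjoint : ∀ b → ι ⌊ u ≈? enum b ⌋ ℕ.* ι ⌊ v ≈? enum b ⌋ ≡ 0
        disjoint b with u ≈? enum b | v ≈? enum b
        ... | yes u≈b | yes v≈b = contradiction (trans u≈b (sym v≈b)) u≉v
        ... | yes _   | no _    = ≡.refl
        ... | no _    | _       = ≡.refl

    array : UTA r (q ℕ.^ n) (q ℕ.* r)
    array = record
      { R = row ; C = column
      ; e = q ℕ.^ suc m ; λrc = q ℕ.^ suc m ; λrr = q ℕ.* (q ℕ.^ suc m ∸ q ℕ.^ m) ; λcc = size (suc m)
      ; R-size = row-size ; C-size = column-size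
      ; R-rep = row-rep ; C-rep = column-rep
      ; RC = row-column ; RR = row-row ; CC = column-column
      }

    sum-class : ∀ l → sum {r} (λ a → ι ⌊ a Fin.≟ l ⌋) ≡ 1
    sum-class l = sum-unique {r} (λ a → a Fin.≟ l) l ≡.refl (λ _ eq → eq)

    -- With e = q^(m+1) and r - 1 = q · (e - 1)/(q - 1), the quotient e(e - 1)/(r - 1) becomes q^m ·
    -- (q - 1).
    λrrc-integral : (q ℕ.^ suc m ∸ q ℕ.^ m) ℕ.* (r ∸ 1) ≡ q ℕ.^ suc m ℕ.* (q ℕ.^ suc m ∸ 1)
    λrrc-integral = begin
      (q ℕ.* q ℕ.^ m ∸ q ℕ.^ m) ℕ.* (r ∸ 1)
        ≡⟨ cong₂ (λ a b → a ℕ.* (b ∸ 1)) (≡.sym (≡.trans (ℕ.*-distribʳ-∸ (q ℕ.^ m) q 1) (cong (q ℕ.^ suc m ∸_) (ℕ.*-identityˡ (q ℕ.^ m))))) (size-suc (suc m)) ⟩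
      ((q ∸ 1) ℕ.* q ℕ.^ m) ℕ.* (q ℕ.* size (suc m))
        ≡⟨ rearrange (q ∸ 1) (q ℕ.^ m) q (size (suc m)) ⟩
      (q ℕ.* q ℕ.^ m) ℕ.* (size (suc m) ℕ.* (q ∸ 1))
        ≡⟨ cong (λ k → q ℕ.^ suc m ℕ.* (k ∸ 1)) (1+size*[q-1]≡q^n (ℕ.>-nonZero⁻¹ q) (suc m)) ⟩
      q ℕ.^ suc m ℕ.* (q ℕ.^ suc m ∸ 1) ∎
      where
      rearrange : ∀ a b c d → (a ℕ.* b) ℕ.* (c ℕ.* d) ≡ (c ℕ.* b) ℕ.* (d ℕ.* a)
      rearrange = solve-∀

    1<r : 1 < r
    1<r = ≡.subst (1 <_) (≡.sym (size-suc (suc m))) (s≤s (≡.subst (λ k → 1 ≤ q ℕ.* k) (≡.sym (size-suc m))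
      (ℕ.>-nonZero⁻¹ (q ℕ.* suc (q ℕ.* size m)) {{ℕ.m*n≢0 q (suc (q ℕ.* size m))}})))

    resolvable : Resolvable array
    resolvable = record
      { λrrc = q ℕ.^ suc m ∸ q ℕ.^ m ; k = q
      ; r>1 = 1<r
      ; λrrc-int = λrrc-integral
      ; e>0 = ℕ.m^n>0 q (suc m)
      ; k-int = ≡.refl
      ; g = class
      ; group-size = λ l → begin
          ∣ group class l ∣                             ≡⟨ ∣tabulate∣ (λ s → ⌊ class s Fin.≟ l ⌋) ⟩
          sum (λ s → ι ⌊ class s Fin.≟ l ⌋)             ≡⟨ sum-rows (λ a → ι ⌊ a Fin.≟ l ⌋) ⟩
          q ℕ.* sum {r} (λ a → ι ⌊ a Fin.≟ l ⌋)             ≡⟨ cong (q ℕ.*_) (sum-class l) ⟩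
          q ℕ.* 1                                       ≡⟨ ℕ.*-identityʳ q ⟩
          q                                             ∎
      ; column-transversal = λ x l → begin
          ∣ column x ∩ group class l ∣
            ≡⟨ ∣tabulate-∩∣ (λ s → incident x (value s) (class s)) (λ s → ⌊ class s Fin.≟ l ⌋) ⟩
          sum (λ s → ι (incident x (value s) (class s)) ℕ.* ι ⌊ class s Fin.≟ l ⌋)
            ≡⟨ sum-column x (λ a → ι ⌊ a Fin.≟ l ⌋) ⟩
          sum {r} (λ a → ι ⌊ a Fin.≟ l ⌋)
            ≡⟨ sum-class l ⟩
          1 ∎
      ; same-rows = λ s t s~t i → begin
          lookup (row i) s      ≡⟨ lookup∘tabulate (λ s → inRow i (class s)) s ⟩
          inRow i (class s)     ≡⟨ cong (inRow i) s~t ⟩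
          inRow i (class t)     ≡⟨ lookup∘tabulate (λ s → inRow i (class s)) t ⟨
          lookup (row i) t      ∎
      }

open import Data.Nat using (_*_; _^_)

theorem5 : ∀ (q n : ℕ) → IsPrimePower q → 2 ≤ n →
    ∀ (r : ℕ) → r * (q ∸ 1) ≡ q ^ n ∸ 1 →
    ResolvableUTA r (q ^ n) (q * r)
theorem5 q (suc (suc n)) (p , suc m , pp , _ , ≡.refl) (s≤s (s≤s _)) r r*[q-1]≡q^n-1 =
  ≡.subst (λ r → ResolvableUTA r (q ^ suc (suc n)) (q * r)) size≡r (TripleArray.array 2≤q n , TripleArray.resolvable 2≤q n)
  where
  2≤q : 2 ≤ p ^ suc m
  2≤q = ℕ.≤-trans (ℕ.nonTrivial⇒n>1 p {{prime⇒nonTrivial pp}}) (ℕ.m≤m*n p (p ^ m) {{ℕ.m^n≢0 p m {{prime⇒nonZero pp}}}})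

  open Geometry (GaloisField.galoisField pp m (q ∸ 2) (≡.sym (ℕ.m+[n∸m]≡n 2≤q)))

  -- Since q - 1 is positive, the product with q - 1 determines r.
  size≡r : size (suc (suc n)) ≡ r
  size≡r = ℕ.*-cancelʳ-≡ _ _ (q ∸ 1) {{ℕ.>-nonZero (ℕ.m<n⇒0<n∸m 2≤q)}}
    (≡.trans (cong (_∸ 1) (1+size*[q-1]≡q^n (ℕ.<⇒≤ 2≤q) (suc (suc n)))) (≡.sym r*[q-1]≡q^n-1))
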